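{- Let $f(t)=1+\sum_{i=1}^{d}\binom{x_i}{i}t^{i}$ be a polynomial with positive integer coefficients, where $x_i\ge i-1$ are real numbers, and suppose all roots of $f(t)$ are real. If $x_{i-1}\ge\lceil x_i\rceil$ for all $2\le i\le d$, then $f(t)$ is the $f$-polynomial of a simplicial complex.
   Context: For real $x$ and integer $k\ge0$, $\binom{x}{k}=\frac{x(x-1)\cdots(x-k+1)}{k!}$; for $k\ge1$ and real $y>0$ there is a unique real $x\ge k-1$ with $\binom{x}{k}=y$. A simplicial complex $\Delta$ on a finite ground set is a family of subsets closed under taking subsets; $f_i$ is the number of faces of cardinality $i+1$ ($f_{ -1}=1$ counts the empty face), and the $f$-polynomial of a $(d-1)$-dimensional $\Delta$ is $\sum_{i=0}^{d}f_{i-1}t^{i}$. A polynomial is called an $f$-polynomial of a simplicial complex if it equals the $f$-polynomial of some simplicial complex. -}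

module Defs where

open import Data.Nat.Base as ℕ using (ℕ; zero; suc; _∸_; _⊔_; _!)
import Data.Nat.Properties as ℕ
open import Data.Integer.Base as ℤ using (ℤ; +_)
open import Data.Rational.Base as ℚ using (ℚ; 0ℚ; 1ℚ; ½; _/_; positive)
import Data.Rational.Properties as ℚ
open import Algebra.Bundles using (CommutativeMonoid)
import Algebra.Properties.CommutativeSemigroup as CommutativeSemigroupProperties
open import Data.Fin.Subset as Subset using (Subset; ∣_∣; _⊆_)
open import Data.List.Base using (List; []; _∷_; map; foldr; filter; length; upTo; applyUpTo)
open import Data.List.Membership.Propositional using (_∈_)
open import Data.List.Relation.Unary.Unique.Propositional using (Unique)
open import Data.Product.Base using (Σ; ∃-syntax; _×_; _,_)
open import Relation.Binary.PropositionalEquality using (_≡_; refl; sym; cong; cong₂; subst)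

------------------------------------------------------------------------
-- Real numbers: Cauchy sequences of rationals, compared up to _≃_

IsCauchy : (ℕ → ℚ) → Set
IsCauchy s = ∀ ε → 0ℚ ℚ.< ε →
  ∃[ N ] (∀ m n → N ℕ.≤ m → N ℕ.≤ n → ℚ.∣ s m ℚ.- s n ∣ ℚ.< ε)

record ℝ : Set where
  constructor mkℝ
  field
    seq    : ℕ → ℚ
    cauchy : IsCauchy seq

open ℝ public

infix 4 _≃_ _≤_ _<_

_≃_ : ℝ → ℝ → Set
x ≃ y = ∀ ε → 0ℚ ℚ.< ε → ∃[ N ] (∀ n → N ℕ.≤ n → ℚ.∣ seq x n ℚ.- seq y n ∣ ℚ.< ε)

_≤_ : ℝ → ℝ → Set
x ≤ y = ∀ ε → 0ℚ ℚ.< ε → ∃[ N ] (∀ n → N ℕ.≤ n → seq x n ℚ.≤ seq y n ℚ.+ ε)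

_<_ : ℝ → ℝ → Set
x < y = ∃[ ε ] (0ℚ ℚ.< ε × ∃[ N ] (∀ n → N ℕ.≤ n → seq x n ℚ.+ ε ℚ.≤ seq y n))

module CauchySequences where

  module Identities where
    open Relation.Binary.PropositionalEquality.≡-Reasoning
    open CommutativeSemigroupProperties (CommutativeMonoid.commutativeSemigroup ℚ.+-0-commutativeMonoid) using (interchange)

    sub-add : ∀ a b → a ≡ (a ℚ.- b) ℚ.+ b
    sub-add a b = sym (begin
      (a ℚ.- b) ℚ.+ b        ≡⟨ ℚ.+-assoc a (ℚ.- b) b ⟩
      a ℚ.+ (ℚ.- b ℚ.+ b)    ≡⟨ cong (a ℚ.+_) (ℚ.+-inverseˡ b) ⟩
      a ℚ.+ 0ℚ               ≡⟨ ℚ.+-identityʳ a ⟩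
      a                      ∎)

    +-diff : ∀ a b c d → (a ℚ.+ b) ℚ.- (c ℚ.+ d) ≡ (a ℚ.- c) ℚ.+ (b ℚ.- d)
    +-diff a b c d = begin
      (a ℚ.+ b) ℚ.- (c ℚ.+ d)               ≡⟨ cong ((a ℚ.+ b) ℚ.+_) (ℚ.neg-distrib-+ c d) ⟩
      (a ℚ.+ b) ℚ.+ (ℚ.- c ℚ.+ ℚ.- d)       ≡⟨ interchange a b (ℚ.- c) (ℚ.- d) ⟩
      (a ℚ.- c) ℚ.+ (b ℚ.- d)               ∎

    *-distribˡ-diff : ∀ a b c → a ℚ.* (b ℚ.- c) ≡ a ℚ.* b ℚ.- a ℚ.* c
    *-distribˡ-diff a b c = begin
      a ℚ.* (b ℚ.- c)                  ≡⟨ ℚ.*-distribˡ-+ a b (ℚ.- c) ⟩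
      a ℚ.* b ℚ.+ a ℚ.* (ℚ.- c)        ≡⟨ cong (a ℚ.* b ℚ.+_) (ℚ.neg-distribʳ-* a c) ⟨
      a ℚ.* b ℚ.- a ℚ.* c              ∎

    *-diff : ∀ a b c d → a ℚ.* b ℚ.- c ℚ.* d ≡ a ℚ.* (b ℚ.- d) ℚ.+ d ℚ.* (a ℚ.- c)
    *-diff a b c d = begin
      a ℚ.* b ℚ.- c ℚ.* d
        ≡⟨ cong (ℚ._- c ℚ.* d) (sub-add (a ℚ.* b) (a ℚ.* d)) ⟩
      (a ℚ.* b ℚ.- a ℚ.* d) ℚ.+ a ℚ.* d ℚ.- c ℚ.* d
        ≡⟨ ℚ.+-assoc (a ℚ.* b ℚ.- a ℚ.* d) (a ℚ.* d) (ℚ.- (c ℚ.* d)) ⟩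
      (a ℚ.* b ℚ.- a ℚ.* d) ℚ.+ (a ℚ.* d ℚ.- c ℚ.* d)
        ≡⟨ cong₂ ℚ._+_ (sym (*-distribˡ-diff a b d))
             (cong₂ ℚ._-_ (ℚ.*-comm a d) (ℚ.*-comm c d)) ⟩
      a ℚ.* (b ℚ.- d) ℚ.+ (d ℚ.* a ℚ.- d ℚ.* c)
        ≡⟨ cong (a ℚ.* (b ℚ.- d) ℚ.+_) (*-distribˡ-diff d a c) ⟨
      a ℚ.* (b ℚ.- d) ℚ.+ d ℚ.* (a ℚ.- c)  ∎

  open Identities using (sub-add; +-diff; *-diff)

  ½*-pos : ∀ {ε} → 0ℚ ℚ.< ε → 0ℚ ℚ.< ½ ℚ.* ε
  ½*-pos {ε} 0<ε = subst (ℚ._< ½ ℚ.* ε) (ℚ.*-zeroʳ ½) (ℚ.*-monoʳ-<-pos ½ 0<ε)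

  halves : ∀ ε → ½ ℚ.* ε ℚ.+ ½ ℚ.* ε ≡ ε
  halves ε = begin
    ½ ℚ.* ε ℚ.+ ½ ℚ.* ε ≡⟨ ℚ.*-distribʳ-+ ε ½ ½ ⟨
    1ℚ ℚ.* ε            ≡⟨ ℚ.*-identityˡ ε ⟩
    ε                   ∎
    where open Relation.Binary.PropositionalEquality.≡-Reasoning

  const-cauchy : ∀ q → IsCauchy (λ _ → q)
  const-cauchy q ε 0<ε = 0 , λ _ _ _ _ →
    subst (ℚ._< ε) (sym (cong ℚ.∣_∣ (ℚ.+-inverseʳ q))) 0<ε

  neg-cauchy : ∀ s → IsCauchy s → IsCauchy (λ n → ℚ.- s n)
  neg-cauchy s cs ε 0<ε with cs ε 0<ε
  ... | N , h = N , λ m n N≤m N≤n → subst (ℚ._< ε) (eq (s m) (s n)) (h m n N≤m N≤n)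
    where
    eq : ∀ a b → ℚ.∣ a ℚ.- b ∣ ≡ ℚ.∣ ℚ.- a ℚ.- ℚ.- b ∣
    eq a b = begin
      ℚ.∣ a ℚ.- b ∣           ≡⟨ ℚ.∣-p∣≡∣p∣ (a ℚ.- b) ⟨
      ℚ.∣ ℚ.- (a ℚ.- b) ∣     ≡⟨ cong ℚ.∣_∣ (ℚ.neg-distrib-+ a (ℚ.- b)) ⟩
      ℚ.∣ ℚ.- a ℚ.- ℚ.- b ∣   ∎
      where open Relation.Binary.PropositionalEquality.≡-Reasoning

  +-cauchy : ∀ s t → IsCauchy s → IsCauchy t → IsCauchy (λ n → s n ℚ.+ t n)
  +-cauchy s t cs ct ε 0<ε with cs (½ ℚ.* ε) (½*-pos 0<ε) | ct (½ ℚ.* ε) (½*-pos 0<ε)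
  ... | M , h | N , k = M ⊔ N , λ m n p q → begin-strict
      ℚ.∣ (s m ℚ.+ t m) ℚ.- (s n ℚ.+ t n) ∣
        ≡⟨ cong ℚ.∣_∣ (+-diff (s m) (t m) (s n) (t n)) ⟩
      ℚ.∣ (s m ℚ.- s n) ℚ.+ (t m ℚ.- t n) ∣
        ≤⟨ ℚ.∣p+q∣≤∣p∣+∣q∣ (s m ℚ.- s n) (t m ℚ.- t n) ⟩
      ℚ.∣ s m ℚ.- s n ∣ ℚ.+ ℚ.∣ t m ℚ.- t n ∣
        <⟨ ℚ.+-mono-< (h m n (ℕ.m⊔n≤o⇒m≤o M N p) (ℕ.m⊔n≤o⇒m≤o M N q))
                      (k m n (ℕ.m⊔n≤o⇒n≤o M N p) (ℕ.m⊔n≤o⇒n≤o M N q)) ⟩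
      ½ ℚ.* ε ℚ.+ ½ ℚ.* ε
        ≡⟨ halves ε ⟩
      ε ∎
    where
    open ℚ.≤-Reasoning

  eventually-bounded : ∀ s → IsCauchy s →
    ∃[ B ] (0ℚ ℚ.< B × ∃[ N ] (∀ n → N ℕ.≤ n → ℚ.∣ s n ∣ ℚ.≤ B))
  eventually-bounded s cs with cs 1ℚ (ℚ.positive⁻¹ 1ℚ)
  ... | N , h = 1ℚ ℚ.+ ℚ.∣ s N ∣
              , ℚ.+-mono-<-≤ (ℚ.positive⁻¹ 1ℚ) (ℚ.0≤∣p∣ (s N))
              , N , λ n N≤n → begin
      ℚ.∣ s n ∣                          ≡⟨ cong ℚ.∣_∣ (sub-add (s n) (s N)) ⟩
      ℚ.∣ (s n ℚ.- s N) ℚ.+ s N ∣        ≤⟨ ℚ.∣p+q∣≤∣p∣+∣q∣ (s n ℚ.- s N) (s N) ⟩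
      ℚ.∣ s n ℚ.- s N ∣ ℚ.+ ℚ.∣ s N ∣
        ≤⟨ ℚ.+-monoˡ-≤ ℚ.∣ s N ∣ (ℚ.<⇒≤ (h n N N≤n ℕ.≤-refl)) ⟩
      1ℚ ℚ.+ ℚ.∣ s N ∣                   ∎
    where
    open ℚ.≤-Reasoning

  scale : ∀ B → 0ℚ ℚ.< B → ∀ ε → 0ℚ ℚ.< ε → ∃[ δ ] (0ℚ ℚ.< δ × B ℚ.* δ ≡ ε)
  scale B 0<B ε 0<ε = B⁻¹ ℚ.* ε , 0<δ , B*δ≡ε
    where
    instance
      B-pos = positive 0<B
      B-nz  = ℚ.pos⇒nonZero B
    B⁻¹ = ℚ.1/ B
    instance
      B⁻¹-pos = ℚ.1/pos⇒pos B
    0<δ = subst (ℚ._< B⁻¹ ℚ.* ε) (ℚ.*-zeroʳ B⁻¹) (ℚ.*-monoʳ-<-pos B⁻¹ 0<ε)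
    open Relation.Binary.PropositionalEquality.≡-Reasoning
    B*δ≡ε = begin
      B ℚ.* (B⁻¹ ℚ.* ε)  ≡⟨ ℚ.*-assoc B B⁻¹ ε ⟨
      B ℚ.* B⁻¹ ℚ.* ε    ≡⟨ cong (ℚ._* ε) (ℚ.*-inverseʳ B) ⟩
      1ℚ ℚ.* ε           ≡⟨ ℚ.*-identityˡ ε ⟩
      ε                  ∎

  ∣*∣-bound : ∀ {a d B δ} → 0ℚ ℚ.< B → ℚ.∣ a ∣ ℚ.≤ B → ℚ.∣ d ∣ ℚ.< δ →
    ℚ.∣ a ℚ.* d ∣ ℚ.< B ℚ.* δ
  ∣*∣-bound {a} {d} {B} {δ} 0<B a≤B d<δ = begin-strict
    ℚ.∣ a ℚ.* d ∣        ≡⟨ ℚ.∣p*q∣≡∣p∣*∣q∣ a d ⟩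
    ℚ.∣ a ∣ ℚ.* ℚ.∣ d ∣  ≤⟨ ℚ.*-monoʳ-≤-nonNeg ℚ.∣ d ∣ {{ℚ.∣-∣-nonNeg d}} a≤B ⟩
    B ℚ.* ℚ.∣ d ∣        <⟨ ℚ.*-monoʳ-<-pos B {{positive 0<B}} d<δ ⟩
    B ℚ.* δ              ∎
    where open ℚ.≤-Reasoning

  *-cauchy : ∀ s t → IsCauchy s → IsCauchy t → IsCauchy (λ n → s n ℚ.* t n)
  *-cauchy s t cs ct ε 0<ε
    with eventually-bounded s cs | eventually-bounded t ct
  ... | B , 0<B , N₁ , bs | C , 0<C , N₂ , bt
    with scale B 0<B (½ ℚ.* ε) (½*-pos 0<ε) | scale C 0<C (½ ℚ.* ε) (½*-pos 0<ε)
  ... | δ , 0<δ , Bδ | η , 0<η , Cη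
    with ct δ 0<δ | cs η 0<η
  ... | N₃ , ht | N₄ , hs = (N₁ ⊔ N₂) ⊔ (N₃ ⊔ N₄) , λ m n p q →
    let p₁₂ = ℕ.m⊔n≤o⇒m≤o (N₁ ⊔ N₂) (N₃ ⊔ N₄) p
        p₃₄ = ℕ.m⊔n≤o⇒n≤o (N₁ ⊔ N₂) (N₃ ⊔ N₄) p
        q₁₂ = ℕ.m⊔n≤o⇒m≤o (N₁ ⊔ N₂) (N₃ ⊔ N₄) q
        q₃₄ = ℕ.m⊔n≤o⇒n≤o (N₁ ⊔ N₂) (N₃ ⊔ N₄) q
    in begin-strict
      ℚ.∣ s m ℚ.* t m ℚ.- s n ℚ.* t n ∣
        ≡⟨ cong ℚ.∣_∣ (*-diff (s m) (t m) (s n) (t n)) ⟩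
      ℚ.∣ s m ℚ.* (t m ℚ.- t n) ℚ.+ t n ℚ.* (s m ℚ.- s n) ∣
        ≤⟨ ℚ.∣p+q∣≤∣p∣+∣q∣ (s m ℚ.* (t m ℚ.- t n)) (t n ℚ.* (s m ℚ.- s n)) ⟩
      ℚ.∣ s m ℚ.* (t m ℚ.- t n) ∣ ℚ.+ ℚ.∣ t n ℚ.* (s m ℚ.- s n) ∣
        <⟨ ℚ.+-mono-<
             (∣*∣-bound {a = s m} {d = t m ℚ.- t n} 0<B (bs m (ℕ.m⊔n≤o⇒m≤o N₁ N₂ p₁₂))
               (ht m n (ℕ.m⊔n≤o⇒m≤o N₃ N₄ p₃₄) (ℕ.m⊔n≤o⇒m≤o N₃ N₄ q₃₄)))
             (∣*∣-bound {a = t n} {d = s m ℚ.- s n} 0<C (bt n (ℕ.m⊔n≤o⇒n≤o N₁ N₂ q₁₂))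
               (hs m n (ℕ.m⊔n≤o⇒n≤o N₃ N₄ p₃₄) (ℕ.m⊔n≤o⇒n≤o N₃ N₄ q₃₄))) ⟩
      B ℚ.* δ ℚ.+ C ℚ.* η
        ≡⟨ cong₂ ℚ._+_ Bδ Cη ⟩
      ½ ℚ.* ε ℚ.+ ½ ℚ.* ε
        ≡⟨ halves ε ⟩
      ε ∎
    where
    open ℚ.≤-Reasoning

open CauchySequences using (const-cauchy; neg-cauchy; +-cauchy; *-cauchy)

infixl 7 _*_
infixl 6 _+_ _-_
infix  8 -_

fromℚ : ℚ → ℝ
fromℚ q = mkℝ (λ _ → q) (const-cauchy q)

_+_ : ℝ → ℝ → ℝ
x + y = mkℝ (λ n → seq x n ℚ.+ seq y n) (+-cauchy (seq x) (seq y) (cauchy x) (cauchy y))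

-_ : ℝ → ℝ
- x = mkℝ (λ n → ℚ.- seq x n) (neg-cauchy (seq x) (cauchy x))

_-_ : ℝ → ℝ → ℝ
x - y = x + (- y)

_*_ : ℝ → ℝ → ℝ
x * y = mkℝ (λ n → seq x n ℚ.* seq y n) (*-cauchy (seq x) (seq y) (cauchy x) (cauchy y))

fromℤ : ℤ → ℝ
fromℤ i = fromℚ (i / 1)

fromℕ : ℕ → ℝ
fromℕ n = fromℤ (+ n)

0ℝ 1ℝ : ℝ
0ℝ = fromℕ 0
1ℝ = fromℕ 1

IsCeiling : ℝ → ℤ → Set
IsCeiling x n = fromℤ (n ℤ.- + 1) < x × x ≤ fromℤ n

-- The ceiling is not a computable function on ℝ, so it enters as a relation.
-- Since the ceiling of y is unique, this universal form is implied by
-- ∃[ n ] (IsCeiling y n × fromℤ n ≤ x), and classically equivalent to it.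
_≥⌈_⌉ : ℝ → ℝ → Set
x ≥⌈ y ⌉ = ∀ n → IsCeiling y n → fromℤ n ≤ x

IsPositiveInteger : ℝ → Set
IsPositiveInteger x = ∃[ n ] (0 ℕ.< n × x ≃ fromℕ n)

-- x (x - 1) ⋯ (x - k + 1)
fallingFactorial : ℝ → ℕ → ℝ
fallingFactorial x zero    = 1ℝ
fallingFactorial x (suc k) = fallingFactorial x k * (x - fromℕ k)

binomial : ℝ → ℕ → ℝ
binomial x k = fallingFactorial x k * fromℚ ((+ 1 / (k !)) {{k ℕ.!≢0}})

------------------------------------------------------------------------
-- Complex numbers and polynomials

record ℂ : Set where
  constructor _+i_
  field
    re im : ℝ

open ℂ public

ofReal : ℝ → ℂ
ofReal a = a +i 0ℝ

_+ℂ_ : ℂ → ℂ → ℂ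
z +ℂ w = (re z + re w) +i (im z + im w)

_*ℂ_ : ℂ → ℂ → ℂ
z *ℂ w = (re z * re w - im z * im w) +i (re z * im w + im z * re w)

_≃ℂ_ : ℂ → ℂ → Set
z ≃ℂ w = re z ≃ re w × im z ≃ im w

-- Coefficient lists, constant term first; trailing zeros are immaterial.
Polynomial : Set
Polynomial = List ℝ

coeff : Polynomial → ℕ → ℝ
coeff []      _       = 0ℝ
coeff (a ∷ p) zero    = a
coeff (a ∷ p) (suc k) = coeff p k

_≃ₚ_ : Polynomial → Polynomial → Set
p ≃ₚ q = ∀ k → coeff p k ≃ coeff q k

eval : Polynomial → ℂ → ℂ
eval p z = foldr (λ a v → ofReal a +ℂ (z *ℂ v)) (ofReal 0ℝ) p

AllRootsReal : Polynomial → Set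
AllRootsReal p = ∀ z → eval p z ≃ℂ ofReal 0ℝ → im z ≃ 0ℝ

-- 1 + Σ_{i=1}^{d} binomial (x i) i tⁱ; only the values x 1, …, x d matter.
binomialPolynomial : (d : ℕ) → (ℕ → ℝ) → Polynomial
binomialPolynomial d x = 1ℝ ∷ applyUpTo (λ j → binomial (x (suc j)) (suc j)) d

------------------------------------------------------------------------
-- Simplicial complexes

-- A family of subsets of an n-element ground set is listed without
-- repetition, so that faces can be counted by length.  The empty face is
-- always present, in accordance with f₋₁ = 1.
record SimplicialComplex (n : ℕ) : Set where
  field
    faces       : List (Subset n)
    unique      : Unique faces
    empty-face  : Subset.⊥ ∈ faces
    down-closed : ∀ {σ τ} → σ ⊆ τ → τ ∈ faces → σ ∈ faces

open SimplicialComplex public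

-- The number of faces of cardinality k, that is, f_{k-1}.
faceCount : ∀ {n} → SimplicialComplex n → ℕ → ℕ
faceCount Δ k = length (filter (λ σ → ∣ σ ∣ ℕ.≟ k) (faces Δ))

-- The largest cardinality of a face, that is, dim Δ + 1.
rank : ∀ {n} → SimplicialComplex n → ℕ
rank Δ = foldr _⊔_ 0 (map ∣_∣ (faces Δ))

fPolynomial : ∀ {n} → SimplicialComplex n → Polynomial
fPolynomial Δ = map (λ k → fromℕ (faceCount Δ k)) (upTo (suc (rank Δ)))

IsFPolynomial : Polynomial → Set
IsFPolynomial p = ∃[ n ] Σ (SimplicialComplex n) (λ Δ → p ≃ₚ fPolynomial Δ)

{-# OPTIONS --safe #-}

-- Put aᵢ = binomial (x i) i, and let Nᵢ be the least N with aᵢ ≤ N C i, which is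
-- the ceiling of x i.  The hypothesis says Nᵢ₊₁ ≤ x i, hence Nᵢ₊₁ C i ≤ aᵢ by
-- monotonicity of the binomial coefficients.  So the first aᵢ subsets of size i
-- in colexicographic order include all i-subsets of {0, …, Nᵢ₊₁ - 1}, while the
-- first aᵢ₊₁ subsets of size i + 1 are contained in {0, …, Nᵢ₊₁ - 1}: together
-- these initial segments form a simplicial complex.

module Submission where

open import Defs
open import Data.Nat.Base as ℕ using (ℕ; zero; suc; _∸_; _⊓_; _⊔_; _!)
import Data.Nat.Properties as ℕ
open import Data.Nat.Combinatorics
import Data.Nat.Coprimality as Coprimality
open import Data.Nat.Solver using () renaming (module +-*-Solver to ℕ-Solver)
open import Data.Integer.Base as ℤ using (+_)
import Data.Integer.Properties as ℤ
open import Data.Rational.Base as ℚ using (ℚ; mkℚ; 0ℚ; 1ℚ; ½; *≤*)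
import Data.Rational.Properties as ℚ
import Data.Rational.Unnormalised.Base as ℚᵘ
import Data.Rational.Unnormalised.Properties as ℚᵘ
open import Data.Rational.Solver using (module +-*-Solver)
open import Data.Bool.Base using (true; false)
open import Data.Empty using (⊥)
open import Data.Fin.Subset as Subset using (Subset; inside; outside; ∣_∣; _⊆_)
import Data.Fin.Subset.Properties as Subset
open import Data.Vec.Base using ([]; _∷_; here)
import Data.Vec.Properties as Vec
open import Data.List.Base using (List; []; _∷_; map; foldr; filter; length; upTo; applyUpTo; _++_)
import Data.List.Properties as List
open import Data.List.Membership.Propositional using (_∈_)
import Data.List.Membership.Propositional.Properties as ∈
open import Data.List.Relation.Unary.Any using (here; there)
open import Data.List.Relation.Unary.All as All using (All; []; _∷_)
import Data.List.Relation.Unary.All.Properties as All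
open import Data.List.Relation.Unary.AllPairs using ([]; _∷_)
open import Data.List.Relation.Unary.Unique.Propositional using (Unique)
import Data.List.Relation.Unary.Unique.Propositional.Properties as Unique
open import Data.Product.Base using (∃-syntax; _×_; _,_; proj₁; proj₂)
open import Data.Sum.Base using (_⊎_; inj₁; inj₂)
open import Function.Base using (_∘_)
open import Level using (0ℓ)
open import Relation.Nullary using (¬_; Dec; yes; no; contradiction; does; _×-dec_)
open import Relation.Nullary.Decidable using (from-yes)
open import Relation.Unary using (Pred; Decidable)
open import Relation.Binary.PropositionalEquality

-- Ceilings of real numbers are only a relation here, so the hypothesis can be applied only to a
-- natural number already shown to be a ceiling. Each Nᵢ is therefore found by a decidable search
-- that sees only the integer aᵢ, and is certified as the ceiling of x i afterwards. The terms of a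
-- Cauchy sequence for x i may lie slightly below i - 1, where the binomial coefficient is no longer
-- monotone, so the comparisons need some slack to the left of that point. Integrality supplies the
-- room for approximation: distinct integers differ by at least 1, and this unit is split into one
-- half for the error of approximating x i and one half for a small change of the argument. The
-- hypothesis also gives Nᵢ₊₁ ≤ x i ≤ Nᵢ. Since the Nᵢ decrease, {0, ..., N₁ - 1} is a large enough
-- ground set, and subsets that are smaller by more than one element are covered as well.

variable
  m n k : ℕ

-- Binomial coefficients

nC0≡1 : ∀ n → n C 0 ≡ 1
nC0≡1 n = trans (nCk≡nC[n∸k] {0} {n} ℕ.z≤n) (nCn≡1 n)

pascal : ∀ n k → suc n C suc k ≡ n C suc k ℕ.+ n C k
pascal n k = trans (sym (nCk+nC[k+1]≡[n+1]C[k+1] n k)) (ℕ.+-comm (n C k) (n C suc k))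

C-monoˡ-≤ : ∀ k → m ℕ.≤ n → m C k ℕ.≤ n C k
C-monoˡ-≤ {m} {n} zero    m≤n = ℕ.≤-reflexive (trans (nC0≡1 m) (sym (nC0≡1 n)))
C-monoˡ-≤ {n = n} (suc k) ℕ.z≤n = ℕ.z≤n
C-monoˡ-≤ {suc m} {suc n} (suc k) (ℕ.s≤s m≤n) =
  subst₂ ℕ._≤_ (sym (pascal m k)) (sym (pascal n k))
    (ℕ.+-mono-≤ (C-monoˡ-≤ (suc k) m≤n) (C-monoˡ-≤ k m≤n))

-- This is the identity (k + 1) C(n, k+1) = (n - k) C(n, k) with the subtraction moved across, so
-- that it needs no assumption k ≤ n. It matches the recursion of the falling factorial and links it
-- to `_C_` in `ff-ι`.
absorption : ∀ n k → suc k ℕ.* (n C suc k) ℕ.+ k ℕ.* (n C k) ≡ n ℕ.* (n C k)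
absorption zero    zero    = refl
absorption zero    (suc k) = cong₂ ℕ._+_ (ℕ.*-zeroʳ (suc (suc k))) (ℕ.*-zeroʳ (suc k))
absorption (suc n) zero    = begin
  (1 ℕ.* (suc n C 1)) ℕ.+ 0 ≡⟨ ℕ.+-identityʳ _ ⟩
  1 ℕ.* (suc n C 1)         ≡⟨ ℕ.*-identityˡ _ ⟩
  suc n C 1               ≡⟨ nC1≡n (suc n) ⟩
  suc n                   ≡⟨ ℕ.*-identityʳ (suc n) ⟨
  suc n ℕ.* 1             ≡⟨ cong (suc n ℕ.*_) (nC0≡1 (suc n)) ⟨
  suc n ℕ.* (suc n C 0)     ∎
  where open ≡-Reasoning
absorption (suc n) (suc k)
  rewrite pascal n (suc k) | pascal n k = begin
  suc (suc k) ℕ.* (c₂ ℕ.+ c₁) ℕ.+ suc k ℕ.* (c₁ ℕ.+ c₀)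
    ≡⟨ regroup (suc k) k c₀ c₁ c₂ ⟩
  (suc (suc k) ℕ.* c₂ ℕ.+ suc k ℕ.* c₁) ℕ.+ (suc k ℕ.* c₁ ℕ.+ k ℕ.* c₀) ℕ.+ (c₁ ℕ.+ c₀)
    ≡⟨ cong (ℕ._+ (c₁ ℕ.+ c₀)) (cong₂ ℕ._+_ (absorption n (suc k)) (absorption n k)) ⟩
  n ℕ.* c₁ ℕ.+ n ℕ.* c₀ ℕ.+ (c₁ ℕ.+ c₀)
    ≡⟨ collect n c₀ c₁ ⟩
  suc n ℕ.* (c₁ ℕ.+ c₀) ∎
  where
  open ≡-Reasoning
  open ℕ-Solver
  c₀ = n C k
  c₁ = n C suc k
  c₂ = n C suc (suc k)
  regroup : ∀ l k c₀ c₁ c₂ → suc l ℕ.* (c₂ ℕ.+ c₁) ℕ.+ suc k ℕ.* (c₁ ℕ.+ c₀) ≡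
    (suc l ℕ.* c₂ ℕ.+ suc k ℕ.* c₁) ℕ.+ (l ℕ.* c₁ ℕ.+ k ℕ.* c₀) ℕ.+ (c₁ ℕ.+ c₀)
  regroup = solve 5 (λ l k c₀ c₁ c₂ →
    (con 1 :+ l) :* (c₂ :+ c₁) :+ (con 1 :+ k) :* (c₁ :+ c₀) :=
    ((con 1 :+ l) :* c₂ :+ (con 1 :+ k) :* c₁) :+ (l :* c₁ :+ k :* c₀) :+ (c₁ :+ c₀)) refl
  collect : ∀ n c₀ c₁ → n ℕ.* c₁ ℕ.+ n ℕ.* c₀ ℕ.+ (c₁ ℕ.+ c₀) ≡ suc n ℕ.* (c₁ ℕ.+ c₀)
  collect = solve 3 (λ n c₀ c₁ →
    n :* c₁ :+ n :* c₀ :+ (c₁ :+ c₀) := (con 1 :+ n) :* (c₁ :+ c₀)) refl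

-- Each step of Pascal's rule adds at least C(k, k) = 1. The bound provides a starting point for the
-- search for N.
a≤[k+a]C[k+1] : ∀ k a → a ℕ.≤ (k ℕ.+ a) C suc k
a≤[k+a]C[k+1] k zero    = ℕ.z≤n
a≤[k+a]C[k+1] k (suc a) = begin
  suc a                                ≡⟨ ℕ.+-comm 1 a ⟩
  a ℕ.+ 1                              ≤⟨ ℕ.+-mono-≤ (a≤[k+a]C[k+1] k a) 1≤C ⟩
  (k ℕ.+ a) C suc k ℕ.+ (k ℕ.+ a) C k  ≡⟨ pascal (k ℕ.+ a) k ⟨
  suc (k ℕ.+ a) C suc k                ≡⟨ cong (_C suc k) (ℕ.+-suc k a) ⟨
  (k ℕ.+ suc a) C suc k                ∎
  where
  open ℕ.≤-Reasoning
  1≤C : 1 ℕ.≤ (k ℕ.+ a) C k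
  1≤C = subst (ℕ._≤ (k ℕ.+ a) C k) (nCn≡1 k) (C-monoˡ-≤ k (ℕ.m≤m+n k a))

-- The search descends from n and stops at the first failure. For monotone `g`, failure at the
-- predecessor alone already means that N is least; phrasing it through `N ≡ suc M` makes it vacuous
-- at N = 0.
leastAbove : ∀ (g : ℕ → ℕ) a n → a ℕ.≤ g n →
  ∃[ N ] (a ℕ.≤ g N × (∀ M → N ≡ suc M → g M ℕ.< a))
leastAbove g a zero    a≤ = zero , a≤ , λ _ ()
leastAbove g a (suc n) a≤ with a ℕ.≤? g n
... | yes a≤gn = leastAbove g a n a≤gn
... | no  a≰gn = suc n , a≤ , λ { M refl → ℕ.≰⇒> a≰gn }

-- Colexicographic rank

-- An element of Subset n at position i stands for the number n - 1 - i, so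
-- that the head of the vector decides about the largest element.  Among the
-- subsets of a given cardinality, those inside {0, …, m-1} come first; span is
-- the least such m.
colexRank : Subset n → ℕ
colexRank []                    = 0
colexRank (outside ∷ σ)         = colexRank σ
colexRank {suc n} (inside ∷ σ)  = n C suc ∣ σ ∣ ℕ.+ colexRank σ

span : Subset n → ℕ
span []                    = 0
span (outside ∷ σ)         = span σ
span {suc n} (inside ∷ σ)  = suc n

span≤n : (σ : Subset n) → span σ ℕ.≤ n
span≤n []            = ℕ.z≤n
span≤n (outside ∷ σ) = ℕ.m≤n⇒m≤1+n (span≤n σ)
span≤n (inside ∷ σ)  = ℕ.≤-refl

span-mono : (σ τ : Subset n) → σ ⊆ τ → span σ ℕ.≤ span τ
span-mono []            []            σ⊆τ = ℕ.z≤n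
span-mono (outside ∷ σ) (outside ∷ τ) σ⊆τ = span-mono σ τ (Subset.drop-∷-⊆ σ⊆τ)
span-mono (s ∷ σ)       (inside ∷ τ)  σ⊆τ = span≤n (s ∷ σ)
span-mono (inside ∷ σ)  (outside ∷ τ) σ⊆τ with () ← σ⊆τ here

-- If the largest element of the set is n, the sets avoiding n account for C(n, k+1) ranks, where k
-- is the number of remaining elements; these have rank below C(n, k), and Pascal's rule adds the
-- two numbers.
colexRank<spanC : (σ : Subset n) → colexRank σ ℕ.< span σ C ∣ σ ∣
colexRank<spanC []                   = ℕ.s≤s ℕ.z≤n
colexRank<spanC (outside ∷ σ)        = colexRank<spanC σ
colexRank<spanC {suc n} (inside ∷ σ) = begin-strict
  n C suc ∣ σ ∣ ℕ.+ colexRank σ   <⟨ ℕ.+-monoʳ-< (n C suc ∣ σ ∣) (ℕ.<-≤-trans (colexRank<spanC σ) (C-monoˡ-≤ ∣ σ ∣ (span≤n σ))) ⟩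
  n C suc ∣ σ ∣ ℕ.+ n C ∣ σ ∣     ≡⟨ pascal n ∣ σ ∣ ⟨
  suc n C suc ∣ σ ∣              ∎
  where open ℕ.≤-Reasoning

-- The largest element of σ is m, so all sets of the same size inside {0, ..., m-1} precede it.
[span-1]C≤colexRank : (σ : Subset n) → span σ ≡ suc m → m C ∣ σ ∣ ℕ.≤ colexRank σ
[span-1]C≤colexRank (outside ∷ σ) eq   = [span-1]C≤colexRank σ eq
[span-1]C≤colexRank (inside ∷ σ)  refl = ℕ.m≤m+n _ _

colexRank<⇒span≤ : (σ : Subset n) → colexRank σ ℕ.< m C ∣ σ ∣ → span σ ℕ.≤ m
colexRank<⇒span≤ {m = m} σ r< with span σ in eq
... | zero  = ℕ.z≤n
... | suc l with suc l ℕ.≤? m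
...   | yes l<m = l<m
...   | no  l≮m = contradiction r< (ℕ.≤⇒≯
  (ℕ.≤-trans (C-monoˡ-≤ ∣ σ ∣ (ℕ.≤-pred (ℕ.≰⇒> l≮m))) ([span-1]C≤colexRank σ eq)))

⊆⇒≡⊎∣∣< : (σ τ : Subset n) → σ ⊆ τ → σ ≡ τ ⊎ ∣ σ ∣ ℕ.< ∣ τ ∣
⊆⇒≡⊎∣∣< []            []            σ⊆τ = inj₁ refl
⊆⇒≡⊎∣∣< (outside ∷ σ) (inside ∷ τ)  σ⊆τ =
  inj₂ (ℕ.s≤s (Subset.p⊆q⇒∣p∣≤∣q∣ (Subset.drop-∷-⊆ σ⊆τ)))
⊆⇒≡⊎∣∣< (inside ∷ σ)  (outside ∷ τ) σ⊆τ with () ← σ⊆τ here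
⊆⇒≡⊎∣∣< (outside ∷ σ) (outside ∷ τ) σ⊆τ with ⊆⇒≡⊎∣∣< σ τ (Subset.drop-∷-⊆ σ⊆τ)
... | inj₁ eq = inj₁ (cong (outside ∷_) eq)
... | inj₂ lt = inj₂ lt
⊆⇒≡⊎∣∣< (inside ∷ σ)  (inside ∷ τ)  σ⊆τ with ⊆⇒≡⊎∣∣< σ τ (Subset.drop-∷-⊆ σ⊆τ)
... | inj₁ eq = inj₁ (cong (inside ∷_) eq)
... | inj₂ lt = inj₂ (ℕ.s≤s lt)

-- Enumeration of subsets

subsets : ∀ n → List (Subset n)
subsets zero    = [] ∷ []
subsets (suc n) = map (outside ∷_) (subsets n) ++ map (inside ∷_) (subsets n)

∈-subsets : (σ : Subset n) → σ ∈ subsets n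
∈-subsets []            = here refl
∈-subsets (outside ∷ σ) = ∈.∈-++⁺ˡ (∈.∈-map⁺ (outside ∷_) (∈-subsets σ))
∈-subsets (inside ∷ σ)  = ∈.∈-++⁺ʳ (map (outside ∷_) (subsets _)) (∈.∈-map⁺ (inside ∷_) (∈-subsets σ))

subsets-unique : ∀ n → Unique (subsets n)
subsets-unique zero    = [] ∷ []
subsets-unique (suc n) = Unique.++⁺
  (Unique.map⁺ Vec.∷-injectiveʳ (subsets-unique n))
  (Unique.map⁺ Vec.∷-injectiveʳ (subsets-unique n))
  λ (p , q) → disjoint (∈.∈-map⁻ (outside ∷_) p) (∈.∈-map⁻ (inside ∷_) q)
  where
  disjoint : ∀ {σ} → ∃[ τ ] (τ ∈ subsets n × σ ≡ outside ∷ τ) →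
    ∃[ τ ] (τ ∈ subsets n × σ ≡ inside ∷ τ) → ⊥
  disjoint (_ , _ , refl) (_ , _ , ())

-- Counting colexicographic initial segments

module _ {A : Set} {P : Pred A 0ℓ} (P? : Decidable P) where

  length-filter-map : {B : Set} (f : B → A) → ∀ xs →
    length (filter P? (map f xs)) ≡ length (filter (P? ∘ f) xs)
  length-filter-map f []       = refl
  length-filter-map f (x ∷ xs) with does (P? (f x))
  ... | true  = cong suc (length-filter-map f xs)
  ... | false = length-filter-map f xs

  filter-filter : {Q : Pred A 0ℓ} (Q? : Decidable Q) → ∀ xs →
    filter P? (filter Q? xs) ≡ filter (λ x → P? x ×-dec Q? x) xs
  filter-filter Q? [] = refl
  filter-filter Q? (x ∷ xs) with does (Q? x) | does (P? x) in eq
  ... | true  | true  rewrite eq = cong (x ∷_) (filter-filter Q? xs)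
  ... | true  | false rewrite eq = filter-filter Q? xs
  ... | false | true  = filter-filter Q? xs
  ... | false | false = filter-filter Q? xs

+<⇒<∸ : ∀ c {r b} → c ℕ.+ r ℕ.< b → r ℕ.< b ∸ c
+<⇒<∸ c {r} {b} lt = ℕ.m+n≤o⇒m≤o∸n (suc r) (subst (ℕ._< b) (ℕ.+-comm c r) lt)

<∸⇒+< : ∀ c {r} b → r ℕ.< b ∸ c → c ℕ.+ r ℕ.< b
<∸⇒+< zero    b       lt = lt
<∸⇒+< (suc c) (suc b) lt = ℕ.s≤s (<∸⇒+< c b lt)

InSegment : ℕ → ℕ → Subset n → Set
InSegment k b σ = ∣ σ ∣ ≡ k × colexRank σ ℕ.< b

inSegment? : ∀ k b → Decidable (InSegment {n} k b)
inSegment? k b σ = (∣ σ ∣ ℕ.≟ k) ×-dec (colexRank σ ℕ.<? b)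

⊓-split : ∀ b c d → b ⊓ c ℕ.+ (b ∸ c) ⊓ d ≡ b ⊓ (c ℕ.+ d)
⊓-split b       zero    d = cong (ℕ._+ b ⊓ d) (ℕ.⊓-zeroʳ b)
⊓-split zero    (suc c) d = refl
⊓-split (suc b) (suc c) d = cong suc (⊓-split b c d)

-- This replaces a proof that the rank is a bijection from the k-subsets onto {0, ..., C(n, k) - 1}.
-- Sets without the top element use up the first C(n, k) ranks; for k ≥ 1, those with it have their
-- ranks shifted by that amount, so only the remainder of b is left for them, and `⊓-split` joins
-- the two counts.
length-segment : ∀ n k b → length (filter (inSegment? k b) (subsets n)) ≡ b ⊓ (n C k)
length-segment zero zero    zero    = refl
length-segment zero zero    (suc b) = cong suc (sym (ℕ.⊓-zeroʳ b))
length-segment zero (suc k) b       = sym (ℕ.⊓-zeroʳ b)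
length-segment (suc n) k b = begin
  length (filter P? (map (outside ∷_) S ++ map (inside ∷_) S))
    ≡⟨ cong length (List.filter-++ P? (map (outside ∷_) S) (map (inside ∷_) S)) ⟩
  length (filter P? (map (outside ∷_) S) ++ filter P? (map (inside ∷_) S))
    ≡⟨ List.length-++ (filter P? (map (outside ∷_) S)) ⟩
  length (filter P? (map (outside ∷_) S)) ℕ.+ length (filter P? (map (inside ∷_) S))
    ≡⟨ cong₂ ℕ._+_ (length-filter-map P? (outside ∷_) S) (length-filter-map P? (inside ∷_) S) ⟩
  length (filter (inSegment? k b) S) ℕ.+ length (filter (P? ∘ (inside ∷_)) S)
    ≡⟨ cong (ℕ._+ length (filter (P? ∘ (inside ∷_)) S)) (length-segment n k b) ⟩
  b ⊓ (n C k) ℕ.+ length (filter (P? ∘ (inside ∷_)) S)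
    ≡⟨ with-head k ⟩
  b ⊓ (suc n C k) ∎
  where
  open ≡-Reasoning
  S = subsets n
  P? = inSegment? {suc n} k b
  with-head : ∀ k → b ⊓ (n C k) ℕ.+ length (filter (inSegment? k b ∘ (inside ∷_)) S) ≡ b ⊓ (suc n C k)
  with-head zero
    rewrite List.filter-none (inSegment? zero b ∘ (inside ∷_))
              (All.universal (λ { σ (() , _) }) S)
          | nC0≡1 n | nC0≡1 (suc n) = ℕ.+-identityʳ _
  with-head (suc k) = begin
    b ⊓ (n C suc k) ℕ.+ length (filter (inSegment? (suc k) b ∘ (inside ∷_)) S)
      ≡⟨ cong (λ xs → b ⊓ (n C suc k) ℕ.+ length xs)
           (List.filter-≐ (inSegment? (suc k) b ∘ (inside ∷_)) (inSegment? k (b ∸ n C suc k)) ((λ {σ} → to σ) , (λ {σ} → from σ)) S) ⟩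
    b ⊓ (n C suc k) ℕ.+ length (filter (inSegment? k (b ∸ n C suc k)) S)
      ≡⟨ cong (b ⊓ (n C suc k) ℕ.+_) (length-segment n k (b ∸ n C suc k)) ⟩
    b ⊓ (n C suc k) ℕ.+ (b ∸ n C suc k) ⊓ (n C k)
      ≡⟨ ⊓-split b (n C suc k) (n C k) ⟩
    b ⊓ (n C suc k ℕ.+ n C k)
      ≡⟨ cong (b ⊓_) (pascal n k) ⟨
    b ⊓ (suc n C suc k) ∎
    where
    to : ∀ σ → InSegment (suc k) b (inside ∷ σ) → InSegment k (b ∸ n C suc k) σ
    to σ (eq , r<) = ℕ.suc-injective eq , +<⇒<∸ (n C suc k)
      (subst (λ l → n C suc l ℕ.+ colexRank σ ℕ.< b) (ℕ.suc-injective eq) r<)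
    from : ∀ σ → InSegment k (b ∸ n C suc k) σ → InSegment (suc k) b (inside ∷ σ)
    from σ (eq , r<) = cong suc eq ,
      subst (λ l → n C suc l ℕ.+ colexRank σ ℕ.< b) (sym eq) (<∸⇒+< (n C suc k) b r<)

-- Coefficients of polynomials given by lists

coeff-applyUpTo : ∀ (f : ℕ → ℝ) n k → k ℕ.< n → coeff (applyUpTo f n) k ≡ f k
coeff-applyUpTo f (suc n) zero    _           = refl
coeff-applyUpTo f (suc n) (suc k) (ℕ.s≤s k<n) = coeff-applyUpTo (f ∘ suc) n k k<n

coeff-applyUpTo-beyond : ∀ (f : ℕ → ℝ) n k → n ℕ.≤ k → coeff (applyUpTo f n) k ≡ 0ℝ
coeff-applyUpTo-beyond f zero    k       _           = refl
coeff-applyUpTo-beyond f (suc n) (suc k) (ℕ.s≤s n≤k) = coeff-applyUpTo-beyond (f ∘ suc) n k n≤k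

coeff-map-upTo : (f : ℕ → ℕ) → ∀ n → (∀ k → n ℕ.≤ k → f k ≡ 0) → ∀ k →
  coeff (map (λ i → fromℕ (f i)) (upTo n)) k ≡ fromℕ (f k)
coeff-map-upTo f n beyond k = trans
  (cong (λ p → coeff p k) (List.map-applyUpTo (λ i → i) (λ i → fromℕ (f i)) n))
  (cases (k ℕ.<? n))
  where
  cases : Dec (k ℕ.< n) → coeff (applyUpTo (λ i → fromℕ (f i)) n) k ≡ fromℕ (f k)
  cases (yes k<n) = coeff-applyUpTo (λ i → fromℕ (f i)) n k k<n
  cases (no  k≮n) = trans (coeff-applyUpTo-beyond (λ i → fromℕ (f i)) n k (ℕ.≮⇒≥ k≮n))
    (cong fromℕ (sym (beyond k (ℕ.≮⇒≥ k≮n))))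

module _ {A : Set} {P : Pred A 0ℓ} (P? : Decidable P) where

  length-filter>0⇒∈ : ∀ xs → 0 ℕ.< length (filter P? xs) → ∃[ x ] (x ∈ xs × P x)
  length-filter>0⇒∈ xs 0<len with filter P? xs in eq
  ... | y ∷ ys = y , ∈.∈-filter⁻ P? (subst (y ∈_) (sym eq) (here refl))

∈⇒≤max : ∀ {m} xs → m ∈ xs → m ℕ.≤ foldr _⊔_ 0 xs
∈⇒≤max (x ∷ xs) (here refl) = ℕ.m≤m⊔n x _
∈⇒≤max (x ∷ xs) (there m∈)  = ℕ.≤-trans (∈⇒≤max xs m∈) (ℕ.m≤n⊔m x _)

faceCount-beyond : (Δ : SimplicialComplex n) → ∀ k → rank Δ ℕ.< k → faceCount Δ k ≡ 0
faceCount-beyond Δ k rank<k with faceCount Δ k in eq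
... | zero  = refl
... | suc _ with length-filter>0⇒∈ (λ σ → ∣ σ ∣ ℕ.≟ k) (faces Δ) (subst (0 ℕ.<_) (sym eq) (ℕ.s≤s ℕ.z≤n))
...   | σ , σ∈ , refl = contradiction (∈⇒≤max _ (∈.∈-map⁺ ∣_∣ σ∈)) (ℕ.<⇒≱ rank<k)

-- The list stops at the rank, but no face is larger. Hence the formula holds at every index, and
-- the rank of the constructed complex never has to be computed.
coeff-fPolynomial : (Δ : SimplicialComplex n) → ∀ k → coeff (fPolynomial Δ) k ≡ fromℕ (faceCount Δ k)
coeff-fPolynomial Δ = coeff-map-upTo (faceCount Δ) (suc (rank Δ)) (faceCount-beyond Δ)

-- The index of N is shifted: N k is Nₖ₊₁ of the introduction.
module CompressedComplex
  (d : ℕ) (a N : ℕ → ℕ)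
  (a-zero   : a 0 ≡ 1)
  (a-beyond : ∀ k → d ℕ.< k → a k ≡ 0)
  (a-upper  : ∀ k → k ℕ.< d → a (suc k) ℕ.≤ N k C suc k)
  (a-lower  : ∀ k → k ℕ.< d → N k C k ℕ.≤ a k)
  (N-step   : ∀ k → suc k ℕ.< d → N (suc k) ℕ.≤ N k)
  where

  N-antitone : ∀ i j → j ℕ.≤ i → i ℕ.< d → N i ℕ.≤ N j
  N-antitone i j j≤i i<d with ℕ.m≤n⇒m<n∨m≡n j≤i
  N-antitone i       j j≤i i<d | inj₂ refl = ℕ.≤-refl
  N-antitone (suc i) j j≤i i<d | inj₁ (ℕ.s≤s j≤i′) =
    ℕ.≤-trans (N-step i i<d) (N-antitone i j j≤i′ (ℕ.<-trans (ℕ.n<1+n i) i<d))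

  -- The ground set has at least `a k` subsets of size k, so the minimum in `length-segment` is
  -- attained by `a k`.
  a-bound : ∀ k → a k ℕ.≤ N 0 C k
  a-bound zero    = ℕ.≤-reflexive (trans a-zero (sym (nC0≡1 (N 0))))
  a-bound (suc k) with k ℕ.<? d
  ... | yes k<d = ℕ.≤-trans (a-upper k k<d) (C-monoˡ-≤ (suc k) (N-antitone k 0 ℕ.z≤n k<d))
  ... | no  k≮d = ℕ.≤-trans (ℕ.≤-reflexive (a-beyond (suc k) (ℕ.s≤s (ℕ.≮⇒≥ k≮d)))) ℕ.z≤n

  IsFace : Subset n → Set
  IsFace σ = colexRank σ ℕ.< a ∣ σ ∣

  isFace? : Decidable (IsFace {n})
  isFace? σ = colexRank σ ℕ.<? a ∣ σ ∣

  colexRank-⊥ : ∀ n → colexRank (Subset.⊥ {n}) ≡ 0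
  colexRank-⊥ zero    = refl
  colexRank-⊥ (suc n) = colexRank-⊥ n

  isFace-⊥ : ∀ n → IsFace (Subset.⊥ {n})
  isFace-⊥ n rewrite colexRank-⊥ n | Subset.∣⊥∣≡0 n | a-zero = ℕ.s≤s ℕ.z≤n

  -- The sizes of σ and τ may differ by more than one. The span of τ is at most `N i`, and
  -- antitonicity of `N` carries this bound down to the size of σ at once, instead of removing
  -- elements one at a time.
  isFace-⊆ : {σ τ : Subset n} → σ ⊆ τ → IsFace τ → IsFace σ
  isFace-⊆ {σ = σ} {τ} σ⊆τ τ-face with ⊆⇒≡⊎∣∣< σ τ σ⊆τ
  ... | inj₁ refl = τ-face
  ... | inj₂ σ<τ with ∣ τ ∣ in eq
  ...   | suc i with i ℕ.<? d
  ...     | no i≮d rewrite a-beyond (suc i) (ℕ.s≤s (ℕ.≮⇒≥ i≮d)) with () ← τ-face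
  ...     | yes i<d = begin-strict
    colexRank σ          <⟨ colexRank<spanC σ ⟩
    span σ C ∣ σ ∣       ≤⟨ C-monoˡ-≤ ∣ σ ∣ span≤ ⟩
    N ∣ σ ∣ C ∣ σ ∣      ≤⟨ a-lower ∣ σ ∣ (ℕ.<-≤-trans σ<τ i<d) ⟩
    a ∣ σ ∣              ∎
    where
    open ℕ.≤-Reasoning
    span≤ : span σ ℕ.≤ N ∣ σ ∣
    span≤ = begin
      span σ   ≤⟨ span-mono σ τ σ⊆τ ⟩
      span τ   ≤⟨ colexRank<⇒span≤ τ (subst (λ k → colexRank τ ℕ.< N i C k) (sym eq) (ℕ.<-≤-trans τ-face (a-upper i i<d))) ⟩
      N i      ≤⟨ N-antitone i ∣ σ ∣ (ℕ.≤-pred σ<τ) i<d ⟩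
      N ∣ σ ∣  ∎

  complex : SimplicialComplex (N 0)
  complex .faces       = filter isFace? (subsets (N 0))
  complex .unique      = Unique.filter⁺ isFace? (subsets-unique (N 0))
  complex .empty-face  = ∈.∈-filter⁺ isFace? (∈-subsets Subset.⊥) (isFace-⊥ (N 0))
  complex .down-closed {σ} σ⊆τ τ∈ =
    ∈.∈-filter⁺ isFace? (∈-subsets σ) (isFace-⊆ σ⊆τ (proj₂ (∈.∈-filter⁻ isFace? {xs = subsets (N 0)} τ∈)))

  faceCount-complex : ∀ k → faceCount complex k ≡ a k
  faceCount-complex k = begin
    length (filter (λ σ → ∣ σ ∣ ℕ.≟ k) (filter isFace? S))
      ≡⟨ cong length (filter-filter (λ σ → ∣ σ ∣ ℕ.≟ k) isFace? S) ⟩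
    length (filter (λ σ → (∣ σ ∣ ℕ.≟ k) ×-dec isFace? σ) S)
      ≡⟨ cong length (List.filter-≐ (λ σ → (∣ σ ∣ ℕ.≟ k) ×-dec isFace? σ) (inSegment? k (a k))
           ((λ {σ} (eq , r<) → eq , subst (λ l → colexRank σ ℕ.< a l) eq r<)
           , (λ {σ} (eq , r<) → eq , subst (λ l → colexRank σ ℕ.< a l) (sym eq) r<)) S) ⟩
    length (filter (inSegment? k (a k)) S)
      ≡⟨ length-segment (N 0) k (a k) ⟩
    a k ⊓ (N 0 C k)
      ≡⟨ ℕ.m≤n⇒m⊓n≡m (a-bound k) ⟩
    a k ∎
    where
    open ≡-Reasoning
    S = subsets (N 0)

-- Rational arithmetic

ι : ℕ → ℚ
ι n = + n ℚ./ 1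

-- The quotient in `ι n` is normalised through a gcd, which is stuck for a variable n. This explicit
-- normal form lets sums and products unfold.
ι′ : ℕ → ℚ
ι′ n = mkℚ (+ n) 0 (Coprimality.sym (Coprimality.1-coprimeTo n))

ι≡ι′ : ∀ n → ι n ≡ ι′ n
ι≡ι′ n = ℚ.normalize-coprime (Coprimality.sym (Coprimality.1-coprimeTo n))

ι-homo-+ : ∀ m n → ι (m ℕ.+ n) ≡ ι m ℚ.+ ι n
ι-homo-+ m n = begin
  ι (m ℕ.+ n)                              ≡⟨ cong (ℚ._/ 1) (cong₂ ℤ._+_ (ℤ.*-identityʳ (+ m)) (ℤ.*-identityʳ (+ n))) ⟨
  (+ m ℤ.* + 1 ℤ.+ + n ℤ.* + 1) ℚ./ 1      ≡⟨⟩
  ι′ m ℚ.+ ι′ n                            ≡⟨ cong₂ ℚ._+_ (ι≡ι′ m) (ι≡ι′ n) ⟨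
  ι m ℚ.+ ι n                              ∎
  where open ≡-Reasoning

ι-homo-* : ∀ m n → ι (m ℕ.* n) ≡ ι m ℚ.* ι n
ι-homo-* m n = begin
  ι (m ℕ.* n)              ≡⟨ cong (ℚ._/ 1) (ℤ.pos-* m n) ⟩
  (+ m ℤ.* + n) ℚ./ 1      ≡⟨⟩
  ι′ m ℚ.* ι′ n            ≡⟨ cong₂ ℚ._*_ (ι≡ι′ m) (ι≡ι′ n) ⟨
  ι m ℚ.* ι n              ∎
  where open ≡-Reasoning

ι-suc : ∀ n → ι (suc n) ≡ ι n ℚ.+ 1ℚ
ι-suc n = trans (cong ι (ℕ.+-comm 1 n)) (ι-homo-+ n 1)

ι-mono-≤ : ∀ {m n} → m ℕ.≤ n → ι m ℚ.≤ ι n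
ι-mono-≤ {m} {n} m≤n = subst₂ ℚ._≤_ (sym (ι≡ι′ m)) (sym (ι≡ι′ n))
  (*≤* (subst₂ ℤ._≤_ (sym (ℤ.*-identityʳ (+ m))) (sym (ℤ.*-identityʳ (+ n))) (ℤ.+≤+ m≤n)))

0≤1 : 0ℚ ℚ.≤ 1ℚ
0≤1 = from-yes (0ℚ ℚ.≤? 1ℚ)

½≤1 : ½ ℚ.≤ 1ℚ
½≤1 = from-yes (½ ℚ.≤? 1ℚ)

0<½ : 0ℚ ℚ.< ½
0<½ = from-yes (0ℚ ℚ.<? ½)

≤⇒≯ : ∀ {p q} → p ℚ.≤ q → ¬ q ℚ.< p
≤⇒≯ p≤q q<p = ℚ.<-irrefl refl (ℚ.<-≤-trans q<p p≤q)

p≤p+q : ∀ {p q} → 0ℚ ℚ.≤ q → p ℚ.≤ p ℚ.+ q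
p≤p+q {p} {q} 0≤q = subst (ℚ._≤ p ℚ.+ q) (ℚ.+-identityʳ p) (ℚ.+-monoʳ-≤ p 0≤q)

p<p+q : ∀ {p q} → 0ℚ ℚ.< q → p ℚ.< p ℚ.+ q
p<p+q {p} {q} 0<q = subst (ℚ._< p ℚ.+ q) (ℚ.+-identityʳ p) (ℚ.+-monoʳ-< p 0<q)

p≤q⇒0≤q-p : ∀ {p q} → p ℚ.≤ q → 0ℚ ℚ.≤ q ℚ.- p
p≤q⇒0≤q-p {p} {q} p≤q = subst (ℚ._≤ q ℚ.- p) (ℚ.+-inverseʳ p) (ℚ.+-monoˡ-≤ (ℚ.- p) p≤q)

p<q⇒0<q-p : ∀ {p q} → p ℚ.< q → 0ℚ ℚ.< q ℚ.- p
p<q⇒0<q-p {p} {q} p<q = subst (ℚ._< q ℚ.- p) (ℚ.+-inverseʳ p) (ℚ.+-monoˡ-< (ℚ.- p) p<q)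

p+[q-p]≡q : ∀ p q → p ℚ.+ (q ℚ.- p) ≡ q
p+[q-p]≡q = solve 2 (λ p q → p :+ (q :- p) := q) refl
  where open +-*-Solver

p-q≤r⇒p≤q+r : ∀ p q {r} → p ℚ.- q ℚ.≤ r → p ℚ.≤ q ℚ.+ r
p-q≤r⇒p≤q+r p q {r} p-q≤r = subst (ℚ._≤ q ℚ.+ r) (p+[q-p]≡q q p) (ℚ.+-monoʳ-≤ q p-q≤r)

p≤q+r⇒p-r≤q : ∀ {p} q r → p ℚ.≤ q ℚ.+ r → p ℚ.- r ℚ.≤ q
p≤q+r⇒p-r≤q {p} q r p≤q+r = subst (p ℚ.- r ℚ.≤_) (eq q r) (ℚ.+-monoˡ-≤ (ℚ.- r) p≤q+r)
  where
  open +-*-Solver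
  eq : ∀ q r → q ℚ.+ r ℚ.- r ≡ q
  eq = solve 2 (λ q r → q :+ r :- r := q) refl

*-nonNeg : ∀ {p q} → 0ℚ ℚ.≤ p → 0ℚ ℚ.≤ q → 0ℚ ℚ.≤ p ℚ.* q
*-nonNeg {p} {q} 0≤p 0≤q = subst (ℚ._≤ p ℚ.* q) (ℚ.*-zeroʳ p)
  (ℚ.*-monoˡ-≤-nonNeg p {{ℚ.nonNegative 0≤p}} 0≤q)

*-pos : ∀ {p q} → 0ℚ ℚ.< p → 0ℚ ℚ.< q → 0ℚ ℚ.< p ℚ.* q
*-pos {p} {q} 0<p 0<q = subst (ℚ._< p ℚ.* q) (ℚ.*-zeroʳ p)
  (ℚ.*-monoʳ-<-pos p {{ℚ.positive 0<p}} 0<q)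

*-mono-≤-nonNeg : ∀ {p q r s} → 0ℚ ℚ.≤ q → 0ℚ ℚ.≤ r → p ℚ.≤ q → r ℚ.≤ s → p ℚ.* r ℚ.≤ q ℚ.* s
*-mono-≤-nonNeg {p} {q} {r} {s} 0≤q 0≤r p≤q r≤s = ℚ.≤-trans
  (ℚ.*-monoʳ-≤-nonNeg r {{ℚ.nonNegative 0≤r}} p≤q)
  (ℚ.*-monoˡ-≤-nonNeg q {{ℚ.nonNegative 0≤q}} r≤s)

p≤∣p∣ : ∀ p → p ℚ.≤ ℚ.∣ p ∣
p≤∣p∣ p with ℚ.≤-total 0ℚ p
... | inj₁ 0≤p = ℚ.≤-reflexive (sym (ℚ.0≤p⇒∣p∣≡p 0≤p))
... | inj₂ p≤0 = ℚ.≤-trans p≤0 (ℚ.0≤∣p∣ p)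

∣p-q∣<r⇒p<q+r : ∀ p q {r} → ℚ.∣ p ℚ.- q ∣ ℚ.< r → p ℚ.< q ℚ.+ r
∣p-q∣<r⇒p<q+r p q {r} lt =
  subst (ℚ._< q ℚ.+ r) (p+[q-p]≡q q p) (ℚ.+-monoʳ-< q (ℚ.≤-<-trans (p≤∣p∣ (p ℚ.- q)) lt))

∣p-q∣<r⇒q<p+r : ∀ p q {r} → ℚ.∣ p ℚ.- q ∣ ℚ.< r → q ℚ.< p ℚ.+ r
∣p-q∣<r⇒q<p+r p q {r} lt = ∣p-q∣<r⇒p<q+r q p (subst (ℚ._< r) ∣p-q∣≡∣q-p∣ lt)
  where
  open +-*-Solver
  ∣p-q∣≡∣q-p∣ : ℚ.∣ p ℚ.- q ∣ ≡ ℚ.∣ q ℚ.- p ∣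
  ∣p-q∣≡∣q-p∣ = trans (sym (ℚ.∣-p∣≡∣p∣ (p ℚ.- q)))
    (cong ℚ.∣_∣ (solve 2 (λ p q → :- (p :- q) := q :- p) refl p q))

n*1/n≡1 : ∀ n .{{_ : ℕ.NonZero n}} → ι n ℚ.* (+ 1 ℚ./ n) ≡ 1ℚ
n*1/n≡1 (suc n) = ℚ.toℚᵘ-injective (ℚᵘ.≃-trans
  (ℚ.toℚᵘ-homo-* (ι (suc n)) (+ 1 ℚ./ suc n))
  (ℚᵘ.≃-trans
    (ℚᵘ.*-cong (ℚ.toℚᵘ-fromℚᵘ (ℚᵘ.mkℚᵘ (+ suc n) 0)) (ℚ.toℚᵘ-fromℚᵘ (ℚᵘ.mkℚᵘ (+ 1) n)))
    (ℚᵘ.*≡* (trans (ℤ.*-identityʳ _) (trans (ℤ.*-identityʳ (+ suc n))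
      (sym (trans (ℤ.*-identityˡ (+ (1 ℕ.* suc n))) (cong +_ (ℕ.*-identityˡ (suc n))))))))))

-- Falling factorials and binomial coefficients of rational numbers

ff : ℚ → ℕ → ℚ
ff q zero    = 1ℚ
ff q (suc k) = ff q k ℚ.* (q ℚ.- ι k)

-- From here on `ι k ≤ y + 1` expresses y ≥ k - 1, the range where the k-th falling factorial is
-- nonnegative and nondecreasing. Adding 1 on the right avoids truncated subtraction at k = 0.
ι-pred-≤ : ∀ k y → ι (suc k) ℚ.≤ y ℚ.+ 1ℚ → ι k ℚ.≤ y
ι-pred-≤ k y le = subst₂ ℚ._≤_ (trans (cong (ℚ._- 1ℚ) (ι-suc k)) (eq (ι k))) (eq y) (ℚ.+-monoˡ-≤ (ℚ.- 1ℚ) le)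
  where
  open +-*-Solver
  eq : ∀ p → p ℚ.+ 1ℚ ℚ.- 1ℚ ≡ p
  eq = solve 1 (λ p → p :+ con 1ℚ :- con 1ℚ := p) refl

ι-weaken-≤ : ∀ k y → ι (suc k) ℚ.≤ y ℚ.+ 1ℚ → ι k ℚ.≤ y ℚ.+ 1ℚ
ι-weaken-≤ k y le = ℚ.≤-trans (ι-mono-≤ (ℕ.n≤1+n k)) le

ff-nonNeg : ∀ k y → ι k ℚ.≤ y ℚ.+ 1ℚ → 0ℚ ℚ.≤ ff y k
ff-nonNeg zero    y le = 0≤1
ff-nonNeg (suc k) y le = *-nonNeg (ff-nonNeg k y (ι-weaken-≤ k y le)) (p≤q⇒0≤q-p (ι-pred-≤ k y le))

ff-pos : ∀ k {y} → ι k ℚ.≤ y → 0ℚ ℚ.< ff y k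
ff-pos zero    le = ℚ.positive⁻¹ 1ℚ
ff-pos (suc k) {y} le = *-pos (ff-pos k (ℚ.<⇒≤ k<y)) (p<q⇒0<q-p k<y)
  where
  k<y : ι k ℚ.< y
  k<y = ℚ.<-≤-trans (p<p+q (ℚ.positive⁻¹ 1ℚ)) (subst (ℚ._≤ y) (ι-suc k) le)

-- A discrete product rule. In the relevant range both summands are products of nonnegative factors,
-- so monotonicity, strict monotonicity and the Lipschitz bound all follow from it by induction or
-- directly.
ff-diff : ∀ k y z → ff z (suc k) ℚ.- ff y (suc k) ≡
  (ff z k ℚ.- ff y k) ℚ.* (z ℚ.- ι k) ℚ.+ ff y k ℚ.* (z ℚ.- y)
ff-diff k y z = solve 5 (λ fz fy z y k → fz :* (z :- k) :- fy :* (y :- k) :=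
  (fz :- fy) :* (z :- k) :+ fy :* (z :- y)) refl (ff z k) (ff y k) z y (ι k)
  where open +-*-Solver

ff-mono-≤ : ∀ k y {z} → ι k ℚ.≤ y ℚ.+ 1ℚ → y ℚ.≤ z → ff y k ℚ.≤ ff z k
ff-mono-≤ zero    y le y≤z = ℚ.≤-refl
ff-mono-≤ (suc k) y {z} le y≤z = subst (ff y (suc k) ℚ.≤_) (p+[q-p]≡q (ff y (suc k)) (ff z (suc k)))
  (p≤p+q (subst (0ℚ ℚ.≤_) (sym (ff-diff k y z)) (ℚ.+-mono-≤
    (*-nonNeg (p≤q⇒0≤q-p (ff-mono-≤ k y k≤y+1 y≤z)) (p≤q⇒0≤q-p (ℚ.≤-trans (ι-pred-≤ k y le) y≤z)))
    (*-nonNeg (ff-nonNeg k y k≤y+1) (p≤q⇒0≤q-p y≤z)))))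
  where
  k≤y+1 = ι-weaken-≤ k y le

ff-mono-< : ∀ k {y z} → ι k ℚ.≤ y → y ℚ.< z → ff y (suc k) ℚ.< ff z (suc k)
ff-mono-< k {y} {z} k≤y y<z = subst (ff y (suc k) ℚ.<_) (p+[q-p]≡q (ff y (suc k)) (ff z (suc k)))
  (p<p+q (subst (0ℚ ℚ.<_) (sym (ff-diff k y z)) (ℚ.+-mono-≤-<
    (*-nonNeg (p≤q⇒0≤q-p (ff-mono-≤ k y (ℚ.≤-trans k≤y (p≤p+q 0≤1)) (ℚ.<⇒≤ y<z))) (p≤q⇒0≤q-p (ℚ.≤-trans k≤y (ℚ.<⇒≤ y<z))))
    (*-pos (ff-pos k k≤y) (p<q⇒0<q-p y<z)))))

-- The falling factorial is nonpositive on [k - 1, k], so its monotonicity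
-- extends one unit to the left as long as the larger argument is at least k.
ff-mono-≤′ : ∀ k y {z} → ι k ℚ.≤ y ℚ.+ 1ℚ → ι k ℚ.≤ z → y ℚ.≤ z → ff y (suc k) ℚ.≤ ff z (suc k)
ff-mono-≤′ k y {z} k≤y+1 k≤z y≤z with ℚ.≤-total (ι k) y
... | inj₁ k≤y = ff-mono-≤ (suc k) y (subst (ℚ._≤ y ℚ.+ 1ℚ) (sym (ι-suc k)) (ℚ.+-monoˡ-≤ 1ℚ k≤y)) y≤z
... | inj₂ y≤k = begin
  ff y k ℚ.* (y ℚ.- ι k)   ≤⟨ ℚ.*-monoˡ-≤-nonNeg (ff y k) {{ℚ.nonNegative (ff-nonNeg k y k≤y+1)}} y-k≤0 ⟩
  ff y k ℚ.* 0ℚ            ≡⟨ ℚ.*-zeroʳ (ff y k) ⟩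
  0ℚ                       ≤⟨ *-nonNeg (ff-nonNeg k z (ℚ.≤-trans k≤z (p≤p+q 0≤1))) (p≤q⇒0≤q-p k≤z) ⟩
  ff z (suc k)             ∎
  where
  open ℚ.≤-Reasoning
  y-k≤0 : y ℚ.- ι k ℚ.≤ 0ℚ
  y-k≤0 = subst (y ℚ.- ι k ℚ.≤_) (ℚ.+-inverseʳ (ι k)) (ℚ.+-monoˡ-≤ (ℚ.- ι k) y≤k)

-- By the product rule this is the derivative of the k-th falling factorial at B, its largest slope
-- on [k - 1, B].
lip : ℕ → ℚ → ℚ
lip zero    B = 0ℚ
lip (suc k) B = lip k B ℚ.* (B ℚ.- ι k) ℚ.+ ff B k

lip-nonNeg : ∀ k B → ι k ℚ.≤ B ℚ.+ 1ℚ → 0ℚ ℚ.≤ lip k B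
lip-nonNeg zero    B le = ℚ.≤-refl
lip-nonNeg (suc k) B le =
  ℚ.+-mono-≤ (*-nonNeg (lip-nonNeg k B k≤B+1) (p≤q⇒0≤q-p (ι-pred-≤ k B le))) (ff-nonNeg k B k≤B+1)
  where k≤B+1 = ι-weaken-≤ k B le

ff-lipschitz : ∀ k y {z B} → ι k ℚ.≤ y ℚ.+ 1ℚ → y ℚ.≤ z → z ℚ.≤ B →
  ff z k ℚ.- ff y k ℚ.≤ (z ℚ.- y) ℚ.* lip k B
ff-lipschitz zero    y {z} le y≤z z≤B = ℚ.≤-reflexive (trans (ℚ.+-inverseʳ 1ℚ) (sym (ℚ.*-zeroʳ (z ℚ.- y))))
ff-lipschitz (suc k) y {z} {B} le y≤z z≤B = begin
  ff z (suc k) ℚ.- ff y (suc k)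
    ≡⟨ ff-diff k y z ⟩
  (ff z k ℚ.- ff y k) ℚ.* (z ℚ.- ι k) ℚ.+ ff y k ℚ.* (z ℚ.- y)
    ≤⟨ ℚ.+-mono-≤
         (*-mono-≤-nonNeg (*-nonNeg 0≤z-y (lip-nonNeg k B (ℚ.≤-trans k≤y+1 (ℚ.+-monoˡ-≤ 1ℚ y≤B))))
           (p≤q⇒0≤q-p (ℚ.≤-trans (ι-pred-≤ k y le) y≤z)) (ff-lipschitz k y k≤y+1 y≤z z≤B) (ℚ.+-monoˡ-≤ (ℚ.- ι k) z≤B))
         (ℚ.*-monoʳ-≤-nonNeg (z ℚ.- y) {{ℚ.nonNegative 0≤z-y}} (ff-mono-≤ k y k≤y+1 y≤B)) ⟩
  (z ℚ.- y) ℚ.* lip k B ℚ.* (B ℚ.- ι k) ℚ.+ ff B k ℚ.* (z ℚ.- y)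
    ≡⟨ solve 4 (λ w l b f → w :* l :* b :+ f :* w := w :* (l :* b :+ f)) refl (z ℚ.- y) (lip k B) (B ℚ.- ι k) (ff B k) ⟩
  (z ℚ.- y) ℚ.* lip (suc k) B ∎
  where
  open ℚ.≤-Reasoning
  open +-*-Solver
  k≤y+1 = ι-weaken-≤ k y le
  y≤B = ℚ.≤-trans y≤z z≤B
  0≤z-y = p≤q⇒0≤q-p y≤z

ff-ι : ∀ m k → ff (ι m) k ≡ ι (k !) ℚ.* ι (m C k)
ff-ι m zero    = trans (sym (ℚ.*-identityʳ 1ℚ)) (cong (λ c → ι 1 ℚ.* ι c) (sym (nC0≡1 m)))
ff-ι m (suc k) = begin
  ff (ι m) k ℚ.* (ι m ℚ.- ι k)
    ≡⟨ cong (ℚ._* (ι m ℚ.- ι k)) (ff-ι m k) ⟩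
  f ℚ.* c₀ ℚ.* (ι m ℚ.- ι k)
    ≡⟨ solve 4 (λ f c m k → f :* c :* (m :- k) := f :* (m :* c :- k :* c)) refl f c₀ (ι m) (ι k) ⟩
  f ℚ.* (ι m ℚ.* c₀ ℚ.- ι k ℚ.* c₀)
    ≡⟨ cong (λ p → f ℚ.* (p ℚ.- ι k ℚ.* c₀)) absorption′ ⟨
  f ℚ.* (ι (suc k) ℚ.* c₁ ℚ.+ ι k ℚ.* c₀ ℚ.- ι k ℚ.* c₀)
    ≡⟨ solve 4 (λ f l c k → f :* (l :* c :+ k :- k) := l :* f :* c) refl f (ι (suc k)) c₁ (ι k ℚ.* c₀) ⟩
  ι (suc k) ℚ.* f ℚ.* c₁
    ≡⟨ cong (ℚ._* c₁) (ι-homo-* (suc k) (k !)) ⟨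
  ι (suc k !) ℚ.* c₁ ∎
  where
  open ≡-Reasoning
  open +-*-Solver
  f = ι (k !)
  c₀ = ι (m C k)
  c₁ = ι (m C suc k)
  absorption′ : ι (suc k) ℚ.* c₁ ℚ.+ ι k ℚ.* c₀ ≡ ι m ℚ.* c₀
  absorption′ = begin
    ι (suc k) ℚ.* c₁ ℚ.+ ι k ℚ.* c₀
      ≡⟨ cong₂ ℚ._+_ (ι-homo-* (suc k) (m C suc k)) (ι-homo-* k (m C k)) ⟨
    ι (suc k ℕ.* (m C suc k)) ℚ.+ ι (k ℕ.* (m C k))
      ≡⟨ ι-homo-+ (suc k ℕ.* (m C suc k)) (k ℕ.* (m C k)) ⟨
    ι (suc k ℕ.* (m C suc k) ℕ.+ k ℕ.* (m C k))
      ≡⟨ cong ι (absorption m k) ⟩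
    ι (m ℕ.* (m C k))
      ≡⟨ ι-homo-* m (m C k) ⟩
    ι m ℚ.* c₀ ∎

1/_! : ℕ → ℚ
1/ k ! = (+ 1 ℚ./ (k !)) {{k ℕ.!≢0}}

1/k!-positive : ∀ k → ℚ.Positive (1/ k !)
1/k!-positive k = ℚ.normalize-pos 1 (k !) {{k ℕ.!≢0}}

1/k!-nonNeg : ∀ k → ℚ.NonNegative (1/ k !)
1/k!-nonNeg k = ℚ.pos⇒nonNeg (1/ k !) {{1/k!-positive k}}

binom : ℚ → ℕ → ℚ
binom q k = ff q k ℚ.* (1/ k !)

binom-ι : ∀ m k → binom (ι m) k ≡ ι (m C k)
binom-ι m k = begin
  ff (ι m) k ℚ.* (1/ k !)             ≡⟨ cong (ℚ._* (1/ k !)) (ff-ι m k) ⟩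
  ι (k !) ℚ.* ι (m C k) ℚ.* (1/ k !)  ≡⟨ solve 3 (λ f c i → f :* c :* i := f :* i :* c) refl (ι (k !)) (ι (m C k)) (1/ k !) ⟩
  ι (k !) ℚ.* (1/ k !) ℚ.* ι (m C k)  ≡⟨ cong (ℚ._* ι (m C k)) (n*1/n≡1 (k !) {{k ℕ.!≢0}}) ⟩
  1ℚ ℚ.* ι (m C k)                    ≡⟨ ℚ.*-identityˡ (ι (m C k)) ⟩
  ι (m C k)                           ∎
  where
  open ≡-Reasoning
  open +-*-Solver

binom-mono-≤ : ∀ k y {z} → ι k ℚ.≤ y ℚ.+ 1ℚ → y ℚ.≤ z → binom y k ℚ.≤ binom z k
binom-mono-≤ k y le y≤z = ℚ.*-monoʳ-≤-nonNeg (1/ k !) {{1/k!-nonNeg k}} (ff-mono-≤ k y le y≤z)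

binom-mono-≤′ : ∀ k y {z} → ι k ℚ.≤ y ℚ.+ 1ℚ → ι k ℚ.≤ z → y ℚ.≤ z → binom y (suc k) ℚ.≤ binom z (suc k)
binom-mono-≤′ k y le k≤z y≤z =
  ℚ.*-monoʳ-≤-nonNeg (1/ suc k !) {{1/k!-nonNeg (suc k)}} (ff-mono-≤′ k y le k≤z y≤z)

binom-mono-< : ∀ k y {z} → ι k ℚ.≤ y → y ℚ.< z → binom y (suc k) ℚ.< binom z (suc k)
binom-mono-< k y k≤y y<z =
  ℚ.*-monoˡ-<-pos (1/ suc k !) {{1/k!-positive (suc k)}} (ff-mono-< k k≤y y<z)

seq-fallingFactorial : ∀ x k n → seq (fallingFactorial x k) n ≡ ff (seq x n) k
seq-fallingFactorial x zero    n = refl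
seq-fallingFactorial x (suc k) n = cong (ℚ._* (seq x n ℚ.- ι k)) (seq-fallingFactorial x k n)

seq-binomial : ∀ x k n → seq (binomial x k) n ≡ binom (seq x n) k
seq-binomial x k n = cong (ℚ._* (1/ k !)) (seq-fallingFactorial x k n)

-- A single step ε works for every y in the range, because the Lipschitz constant depends only on k
-- and B. The allowance ½ is one half of the gap between consecutive integers.
binom-modulus : ∀ k B → ι k ℚ.≤ B ℚ.+ 1ℚ → ∃[ ε ] (0ℚ ℚ.< ε × ε ℚ.≤ 1ℚ ×
  (∀ y → ι k ℚ.≤ y ℚ.+ 1ℚ → y ℚ.+ ε ℚ.≤ B → binom (y ℚ.+ ε) k ℚ.≤ binom y k ℚ.+ ½))
binom-modulus k B k≤B+1 = ε , 0<ε , ε≤1 , bound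
  where
  open ℚ.≤-Reasoning
  open +-*-Solver
  -- Adding 1 makes the constant positive, hence invertible, and forces ε ≤ ½.
  L = lip k B ℚ.* (1/ k !) ℚ.+ 1ℚ
  1≤L : 1ℚ ℚ.≤ L
  1≤L = subst (ℚ._≤ L) (ℚ.+-identityˡ 1ℚ)
    (ℚ.+-monoˡ-≤ 1ℚ (*-nonNeg (lip-nonNeg k B k≤B+1) (ℚ.nonNegative⁻¹ (1/ k !) {{1/k!-nonNeg k}})))
  step = CauchySequences.scale L (ℚ.<-≤-trans (ℚ.positive⁻¹ 1ℚ) 1≤L) ½ 0<½
  ε    = proj₁ step
  0<ε  = proj₁ (proj₂ step)
  Lε≡½ = proj₂ (proj₂ step)
  ε≤½ : ε ℚ.≤ ½
  ε≤½ = begin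
    ε         ≡⟨ ℚ.*-identityˡ ε ⟨
    1ℚ ℚ.* ε  ≤⟨ ℚ.*-monoʳ-≤-nonNeg ε {{ℚ.nonNegative (ℚ.<⇒≤ 0<ε)}} 1≤L ⟩
    L ℚ.* ε   ≡⟨ Lε≡½ ⟩
    ½         ∎
  ε≤1 = ℚ.≤-trans ε≤½ ½≤1
  bound : ∀ y → ι k ℚ.≤ y ℚ.+ 1ℚ → y ℚ.+ ε ℚ.≤ B → binom (y ℚ.+ ε) k ℚ.≤ binom y k ℚ.+ ½
  bound y le y+ε≤B = p-q≤r⇒p≤q+r (binom (y ℚ.+ ε) k) (binom y k) (begin
    ff (y ℚ.+ ε) k ℚ.* (1/ k !) ℚ.- ff y k ℚ.* (1/ k !)
      ≡⟨ solve 3 (λ p q c → p :* c :- q :* c := (p :- q) :* c) refl (ff (y ℚ.+ ε) k) (ff y k) (1/ k !) ⟩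
    (ff (y ℚ.+ ε) k ℚ.- ff y k) ℚ.* (1/ k !)
      ≤⟨ ℚ.*-monoʳ-≤-nonNeg (1/ k !) {{1/k!-nonNeg k}} (ff-lipschitz k y le (p≤p+q (ℚ.<⇒≤ 0<ε)) y+ε≤B) ⟩
    (y ℚ.+ ε ℚ.- y) ℚ.* lip k B ℚ.* (1/ k !)
      ≡⟨ solve 4 (λ y e l c → (y :+ e :- y) :* l :* c := (l :* c) :* e) refl y ε (lip k B) (1/ k !) ⟩
    lip k B ℚ.* (1/ k !) ℚ.* ε
      ≤⟨ ℚ.*-monoʳ-≤-nonNeg ε {{ℚ.nonNegative (ℚ.<⇒≤ 0<ε)}} (p≤p+q {lip k B ℚ.* (1/ k !)} 0≤1) ⟩
    L ℚ.* ε
      ≡⟨ Lε≡½ ⟩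
    ½ ∎)

m<n⇒ιm+½+½≤ιn : ∀ {m n} → m ℕ.< n → ι m ℚ.+ ½ ℚ.+ ½ ℚ.≤ ι n
m<n⇒ιm+½+½≤ιn {m} {n} m<n = subst (ℚ._≤ ι n) (trans (ι-suc m) (sym (ℚ.+-assoc (ι m) ½ ½))) (ι-mono-≤ m<n)

-- Comparing a real number with natural numbers through its binomial coefficients

module _ (x : ℝ) (k a : ℕ) (binomial≃a : binomial x (suc k) ≃ fromℕ a) where

  binom<a+ : ∀ ε → 0ℚ ℚ.< ε → ∃[ N ] (∀ n → N ℕ.≤ n → binom (seq x n) (suc k) ℚ.< ι a ℚ.+ ε)
  binom<a+ ε 0<ε = proj₁ close , λ n N≤n → subst (ℚ._< ι a ℚ.+ ε) (seq-binomial x (suc k) n)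
    (∣p-q∣<r⇒p<q+r (seq (binomial x (suc k)) n) (ι a) (proj₂ close n N≤n))
    where close = binomial≃a ε 0<ε

  a<binom+ : ∀ ε → 0ℚ ℚ.< ε → ∃[ N ] (∀ n → N ℕ.≤ n → ι a ℚ.< binom (seq x n) (suc k) ℚ.+ ε)
  a<binom+ ε 0<ε = proj₁ close , λ n N≤n → subst (λ b → ι a ℚ.< b ℚ.+ ε) (seq-binomial x (suc k) n)
    (∣p-q∣<r⇒q<p+r (seq (binomial x (suc k)) n) (ι a) (proj₂ close n N≤n))
    where close = binomial≃a ε 0<ε

  -- Strict inequality of reals demands a uniform gap ε. It comes from C(M, k+1) + 1 ≤ a: one half
  -- of the unit pays for moving from M to M + ε, the other for the distance of the approximating
  -- binomials from a.
  MC[k+1]<a⇒M<x : fromℕ k ≤ x → ∀ M → k ℕ.≤ M → M C suc k ℕ.< a → fromℕ M < x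
  MC[k+1]<a⇒M<x k≤x M k≤M C<a = ε , 0<ε , N₁ ⊔ N₂ , λ n N≤n → M+ε≤x n
    (proj₂ near-k n (ℕ.m⊔n≤o⇒m≤o N₁ N₂ N≤n)) (proj₂ near-a n (ℕ.m⊔n≤o⇒n≤o N₁ N₂ N≤n))
    where
    open ℚ.≤-Reasoning
    modulus = binom-modulus (suc k) (ι (suc M)) (ℚ.≤-trans (ι-mono-≤ (ℕ.s≤s k≤M)) (p≤p+q 0≤1))
    ε       = proj₁ modulus
    0<ε     = proj₁ (proj₂ modulus)
    ε≤1     = proj₁ (proj₂ (proj₂ modulus))
    bound   = proj₂ (proj₂ (proj₂ modulus))
    -- Tolerance 1 places late terms in [k - 1, ∞), exactly the range that `binom-mono-≤′` accepts
    -- for its smaller argument.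
    near-k  = k≤x 1ℚ (ℚ.positive⁻¹ 1ℚ)
    near-a  = a<binom+ ½ 0<½
    N₁      = proj₁ near-k
    N₂      = proj₁ near-a
    M+ε≤x : ∀ n → ι k ℚ.≤ seq x n ℚ.+ 1ℚ → ι a ℚ.< binom (seq x n) (suc k) ℚ.+ ½ → ι M ℚ.+ ε ℚ.≤ seq x n
    M+ε≤x n k≤x+1 a< = ℚ.≮⇒≥ λ x<M+ε → contradiction a< (≤⇒≯ (begin
      binom (seq x n) (suc k) ℚ.+ ½
        ≤⟨ ℚ.+-monoˡ-≤ ½ (binom-mono-≤′ k (seq x n) k≤x+1
             (ℚ.≤-trans (ι-mono-≤ k≤M) (p≤p+q (ℚ.<⇒≤ 0<ε))) (ℚ.<⇒≤ x<M+ε)) ⟩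
      binom (ι M ℚ.+ ε) (suc k) ℚ.+ ½
        ≤⟨ ℚ.+-monoˡ-≤ ½ (bound (ι M) (subst (ι (suc k) ℚ.≤_) (ι-suc M) (ι-mono-≤ (ℕ.s≤s k≤M)))
             (subst (ι M ℚ.+ ε ℚ.≤_) (sym (ι-suc M)) (ℚ.+-monoʳ-≤ (ι M) ε≤1))) ⟩
      binom (ι M) (suc k) ℚ.+ ½ ℚ.+ ½
        ≡⟨ cong (λ b → b ℚ.+ ½ ℚ.+ ½) (binom-ι M (suc k)) ⟩
      ι (M C suc k) ℚ.+ ½ ℚ.+ ½
        ≤⟨ m<n⇒ιm+½+½≤ιn C<a ⟩
      ι a ∎))

  a≤NC[k+1]⇒x≤N : ∀ N → k ℕ.≤ N → a ℕ.≤ N C suc k → x ≤ fromℕ N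
  a≤NC[k+1]⇒x≤N N k≤N a≤C ε 0<ε = proj₁ near-a , λ n N₁≤n → x≤N+ε n (proj₂ near-a n N₁≤n)
    where
    open ℚ.≤-Reasoning
    k≤N+ε : ι k ℚ.≤ ι N ℚ.+ ε
    k≤N+ε = ℚ.≤-trans (ι-mono-≤ k≤N) (p≤p+q (ℚ.<⇒≤ 0<ε))
    b₀ = binom (ι N) (suc k)
    b₁ = binom (ι N ℚ.+ ε) (suc k)
    -- The tolerance is the growth of the binomial coefficient from N to N + ε. A term beyond N + ε
    -- would exceed a by at least this amount.
    near-a = binom<a+ (b₁ ℚ.- b₀) (p<q⇒0<q-p (binom-mono-< k (ι N) (ι-mono-≤ k≤N) (p<p+q 0<ε)))
    x≤N+ε : ∀ n → binom (seq x n) (suc k) ℚ.< ι a ℚ.+ (b₁ ℚ.- b₀) → seq x n ℚ.≤ ι N ℚ.+ ε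
    x≤N+ε n b< = ℚ.≮⇒≥ λ N+ε<x → contradiction b< (≤⇒≯ (begin
      ι a ℚ.+ (b₁ ℚ.- b₀)            ≤⟨ ℚ.+-monoˡ-≤ (b₁ ℚ.- b₀) (ι-mono-≤ a≤C) ⟩
      ι (N C suc k) ℚ.+ (b₁ ℚ.- b₀)  ≡⟨ cong (ℚ._+ (b₁ ℚ.- b₀)) (binom-ι N (suc k)) ⟨
      b₀ ℚ.+ (b₁ ℚ.- b₀)             ≡⟨ p+[q-p]≡q b₀ b₁ ⟩
      b₁                             ≤⟨ binom-mono-≤′ k (ι N ℚ.+ ε) (ℚ.≤-trans k≤N+ε (p≤p+q 0≤1))
                                          (ℚ.≤-trans k≤N+ε (ℚ.<⇒≤ N+ε<x)) (ℚ.<⇒≤ N+ε<x) ⟩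
      binom (seq x n) (suc k)        ∎))

  least⇒IsCeiling : fromℕ k ≤ x → ∀ N → k ℕ.< N → a ℕ.≤ N C suc k →
    (∀ M → N ≡ suc M → M C suc k ℕ.< a) → IsCeiling x (+ N)
  -- The bound k < N rules out N = 0 and leaves k ≤ M. The integer `+ suc M - + 1` in `IsCeiling`
  -- computes to `+ M`.
  least⇒IsCeiling k≤x (suc M) k<N a≤C C<a =
    MC[k+1]<a⇒M<x k≤x M (ℕ.≤-pred k<N) (C<a M refl) , a≤NC[k+1]⇒x≤N (suc M) (ℕ.<⇒≤ k<N) a≤C

  -- One sufficiently late term of x decides this inequality of integers. The term is only known to
  -- be at least N - ε, so the modulus is applied on the step from N - ε up to N; k < N and ε ≤ 1
  -- keep N - ε in the monotone range.
  N≤x⇒NC[k+1]≤a : ∀ N → k ℕ.< N → fromℕ N ≤ x → N C suc k ℕ.≤ a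
  N≤x⇒NC[k+1]≤a N k<N N≤x = ℕ.≮⇒≥ λ a<C → ℚ.<-irrefl refl (begin-strict
    ι (N C suc k)                  ≡⟨ binom-ι N (suc k) ⟨
    binom (ι N) (suc k)            ≡⟨ cong (λ q → binom q (suc k)) N-ε+ε≡N ⟨
    binom (y ℚ.+ ε) (suc k)        ≤⟨ bound y k<y+1 (ℚ.≤-reflexive N-ε+ε≡N) ⟩
    binom y (suc k) ℚ.+ ½          ≤⟨ ℚ.+-monoˡ-≤ ½ (binom-mono-≤ (suc k) y k<y+1 y≤x) ⟩
    binom (seq x l) (suc k) ℚ.+ ½  <⟨ ℚ.+-monoˡ-< ½ (proj₂ near-a l (ℕ.m≤n⊔m (proj₁ near-N) (proj₁ near-a))) ⟩
    ι a ℚ.+ ½ ℚ.+ ½                ≤⟨ m<n⇒ιm+½+½≤ιn a<C ⟩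
    ι (N C suc k)                  ∎)
    where
    open ℚ.≤-Reasoning
    open +-*-Solver
    modulus = binom-modulus (suc k) (ι N) (ℚ.≤-trans (ι-mono-≤ k<N) (p≤p+q 0≤1))
    ε       = proj₁ modulus
    ε≤1     = proj₁ (proj₂ (proj₂ modulus))
    bound   = proj₂ (proj₂ (proj₂ modulus))
    near-N  = N≤x ε (proj₁ (proj₂ modulus))
    near-a  = binom<a+ ½ 0<½
    l = proj₁ near-N ⊔ proj₁ near-a
    y = ι N ℚ.- ε
    y≤x : y ℚ.≤ seq x l
    y≤x = p≤q+r⇒p-r≤q (seq x l) ε (proj₂ near-N l (ℕ.m≤m⊔n (proj₁ near-N) (proj₁ near-a)))
    N-ε+ε≡N : y ℚ.+ ε ≡ ι N
    N-ε+ε≡N = solve 2 (λ N e → N :- e :+ e := N) refl (ι N) ε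
    k<y+1 : ι (suc k) ℚ.≤ y ℚ.+ 1ℚ
    k<y+1 = ℚ.≤-trans (ι-mono-≤ k<N) (subst (ℚ._≤ y ℚ.+ 1ℚ) N-ε+ε≡N (ℚ.+-monoʳ-≤ y ε≤1))

m≤x≤n⇒m≤n : ∀ {x m n} → fromℕ m ≤ x → x ≤ fromℕ n → m ℕ.≤ n
m≤x≤n⇒m≤n {x} {m} {n} m≤x x≤n = ℕ.≮⇒≥ λ n<m → ℚ.<-irrefl refl (begin-strict
  ι m                  ≤⟨ proj₂ near-m l (ℕ.m≤m⊔n (proj₁ near-m) (proj₁ near-n)) ⟩
  seq x l ℚ.+ ¼        ≤⟨ ℚ.+-monoˡ-≤ ¼ (proj₂ near-n l (ℕ.m≤n⊔m (proj₁ near-m) (proj₁ near-n))) ⟩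
  ι n ℚ.+ ¼ ℚ.+ ¼      ≡⟨ ℚ.+-assoc (ι n) ¼ ¼ ⟩
  ι n ℚ.+ ½            <⟨ p<p+q 0<½ ⟩
  ι n ℚ.+ ½ ℚ.+ ½      ≤⟨ m<n⇒ιm+½+½≤ιn n<m ⟩
  ι m                  ∎)
  where
  open ℚ.≤-Reasoning
  -- Two errors of one quarter stay below the unit gap between integers.
  ¼ = ½ ℚ.* ½
  0<¼ : 0ℚ ℚ.< ¼
  0<¼ = from-yes (0ℚ ℚ.<? ¼)
  near-m = m≤x ¼ 0<¼
  near-n = x≤n ¼ 0<¼
  l = proj₁ near-m ⊔ proj₁ near-n

≃-reflexive : ∀ {x y} → x ≡ y → x ≃ y
≃-reflexive {x} refl ε 0<ε = 0 , λ n _ →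
  subst (ℚ._< ε) (sym (cong ℚ.∣_∣ (ℚ.+-inverseʳ (seq x n)))) 0<ε

theorem3p3 : (d : ℕ) (x : ℕ → ℝ) →
    (∀ i → 1 ℕ.≤ i → i ℕ.≤ d → fromℕ (i ∸ 1) ≤ x i) →
    All IsPositiveInteger (binomialPolynomial d x) →
    AllRootsReal (binomialPolynomial d x) →
    (∀ i → 2 ℕ.≤ i → i ℕ.≤ d → x (i ∸ 1) ≥⌈ x i ⌉) →
    IsFPolynomial (binomialPolynomial d x)
theorem3p3 d x k≤x (_ ∷ coefficients-positive) _ x≥⌈x⌉ = N 0 , complex , same-coefficients
  where
  coefficient : ℕ → ℝ
  coefficient j = binomial (x (suc j)) (suc j)

  -- Both cases are recorded as implications in one type, so `a` is defined by a single decision and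
  -- its properties are projections that need no further case split.
  Integral : ℕ → Set
  Integral j = ∃[ a ] ((j ℕ.< d → 0 ℕ.< a × coefficient j ≃ fromℕ a) × (d ℕ.≤ j → a ≡ 0))

  integral : ∀ j → Dec (j ℕ.< d) → Integral j
  integral j (no  j≮d) = 0 , (λ j<d → contradiction j<d j≮d) , λ _ → refl
  integral j (yes j<d) = proj₁ positive , (λ _ → proj₂ positive) , λ d≤j → contradiction j<d (ℕ.≤⇒≯ d≤j)
    where positive = All.applyUpTo⁻ coefficient d coefficients-positive j<d

  a : ℕ → ℕ
  a zero    = 1
  a (suc j) = proj₁ (integral j (j ℕ.<? d))

  0<a : ∀ {j} → j ℕ.< d → 0 ℕ.< a (suc j)
  0<a {j} j<d = proj₁ (proj₁ (proj₂ (integral j (j ℕ.<? d))) j<d)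

  coefficient≃a : ∀ {j} → j ℕ.< d → coefficient j ≃ fromℕ (a (suc j))
  coefficient≃a {j} j<d = proj₂ (proj₁ (proj₂ (integral j (j ℕ.<? d))) j<d)

  a-beyond : ∀ k → d ℕ.< k → a k ≡ 0
  a-beyond (suc j) (ℕ.s≤s d≤j) = proj₂ (proj₂ (integral j (j ℕ.<? d))) d≤j

  least : ∀ j → ∃[ N ] (a (suc j) ℕ.≤ N C suc j × (∀ M → N ≡ suc M → M C suc j ℕ.< a (suc j)))
  least j = leastAbove (_C suc j) (a (suc j)) (j ℕ.+ a (suc j)) (a≤[k+a]C[k+1] j (a (suc j)))

  N : ℕ → ℕ
  N j = proj₁ (least j)

  a≤NC : ∀ j → a (suc j) ℕ.≤ N j C suc j
  a≤NC j = proj₁ (proj₂ (least j))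

  -- Positivity of the coefficients enters here and keeps `N j` in the range where the binomial
  -- coefficient is monotone.
  j<N : ∀ {j} → j ℕ.< d → j ℕ.< N j
  j<N {j} j<d = ℕ.≰⇒> λ N≤j → ℕ.<⇒≱ (0<a j<d)
    (ℕ.≤-trans (a≤NC j) (ℕ.≤-reflexive (k>n⇒nCk≡0 (ℕ.s≤s N≤j))))

  j≤x : ∀ {j} → j ℕ.< d → fromℕ j ≤ x (suc j)
  j≤x {j} j<d = k≤x (suc j) (ℕ.s≤s ℕ.z≤n) j<d

  x≤N : ∀ {j} → j ℕ.< d → x (suc j) ≤ fromℕ (N j)
  x≤N {j} j<d = a≤NC[k+1]⇒x≤N (x (suc j)) j (a (suc j)) (coefficient≃a j<d) (N j)
    (ℕ.<⇒≤ (j<N j<d)) (a≤NC j)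

  N-isCeiling : ∀ {j} → j ℕ.< d → IsCeiling (x (suc j)) (+ N j)
  N-isCeiling {j} j<d = least⇒IsCeiling (x (suc j)) j (a (suc j)) (coefficient≃a j<d) (j≤x j<d)
    (N j) (j<N j<d) (a≤NC j) (proj₂ (proj₂ (least j)))

  -- The ceiling hypothesis is used at i = j + 2: `N (suc j)` is the ceiling of x at j + 2, compared
  -- with x at j + 1.
  N≤x : ∀ {j} → suc j ℕ.< d → fromℕ (N (suc j)) ≤ x (suc j)
  N≤x {j} j+1<d = x≥⌈x⌉ (suc (suc j)) (ℕ.s≤s (ℕ.s≤s ℕ.z≤n)) j+1<d (+ N (suc j)) (N-isCeiling j+1<d)

  NC≤a : ∀ k → k ℕ.< d → N k C k ℕ.≤ a k
  NC≤a zero    _     = ℕ.≤-reflexive (nC0≡1 (N 0))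
  NC≤a (suc j) j+1<d = N≤x⇒NC[k+1]≤a (x (suc j)) j (a (suc j)) (coefficient≃a j<d) (N (suc j))
    (ℕ.<-trans (ℕ.n<1+n j) (j<N j+1<d)) (N≤x j+1<d)
    where
    j<d = ℕ.<-trans (ℕ.n<1+n j) j+1<d

  N-step : ∀ j → suc j ℕ.< d → N (suc j) ℕ.≤ N j
  N-step j j+1<d = m≤x≤n⇒m≤n {x (suc j)} (N≤x j+1<d) (x≤N (ℕ.<-trans (ℕ.n<1+n j) j+1<d))

  open CompressedComplex d a N refl a-beyond (λ j _ → a≤NC j) NC≤a N-step
    using (complex; faceCount-complex)

  f-coefficient : ∀ k → coeff (fPolynomial complex) k ≡ fromℕ (a k)
  f-coefficient k = trans (coeff-fPolynomial complex k) (cong fromℕ (faceCount-complex k))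

  ≃a : ∀ k → coeff (binomialPolynomial d x) k ≃ fromℕ (a k)
  ≃a zero    = ≃-reflexive {1ℝ} refl
  ≃a (suc j) = cases (j ℕ.<? d)
    where
    cases : Dec (j ℕ.< d) → coeff (applyUpTo coefficient d) j ≃ fromℕ (a (suc j))
    cases (yes j<d) =
      subst (_≃ fromℕ (a (suc j))) (sym (coeff-applyUpTo coefficient d j j<d)) (coefficient≃a j<d)
    cases (no  j≮d) = ≃-reflexive (trans (coeff-applyUpTo-beyond coefficient d j (ℕ.≮⇒≥ j≮d))
      (cong fromℕ (sym (a-beyond (suc j) (ℕ.s≤s (ℕ.≮⇒≥ j≮d))))))

  same-coefficients : binomialPolynomial d x ≃ₚ fPolynomial complex
  same-coefficients k = subst (coeff (binomialPolynomial d x) k ≃_) (sym (f-coefficient k)) (≃a k)
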